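{- Let $T$ be a switch-tree and let $S$ be a convex point set in the plane such that $|S|=|T|$ (the number of points of $S$ equals the number of vertices of $T$). Then $T$ admits an upward planar straight-line embedding (UPSE) into $S$.
   Context: All graphs and point sets are finite and nonempty. A directed tree is a digraph whose underlying undirected graph is a tree; $(u,v)$ denotes an arc directed from $u$ to $v$. A switch-tree is a directed tree in which each vertex is either a source (no incoming arcs) or a sink (no outgoing arcs). A point set in the plane is convex (in convex position) if no point lies in the convex hull of the others; in addition, no two points of the set have the same $y$-coordinate. A UPSE of a digraph $D$ into a point set $S$ with $|S|=|V(D)|$ is a mapping of the vertices of $D$ to distinct points of $S$, and of each arc to the straight-line segment between the images of its end-vertices, such that no two arcs cross (two segments meet only at the image of a common end-vertex) and for each arc $(u,v)$ the image of $u$ has strictly smaller $y$-coordinate than the image of $v$. -}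

module Defs where

open import Algebra.Apartness.Structures using (IsHeytingField)
open import Algebra.Bundles using (CommutativeRing)
open import Algebra.Core using (Op₁; Op₂)
import Algebra.Properties.Semiring.Sum as SemiringSum
open import Data.Fin.Base using (Fin)
open import Data.List.Base using (List; []; _∷_; _∷ʳ_; length)
open import Data.List.Relation.Unary.Linked using (Linked)
open import Data.List.Relation.Unary.Unique.Propositional using (Unique)
open import Data.Empty using (⊥)
open import Data.Nat.Base using (ℕ; suc) renaming (_≤_ to _≤ᴺ_)
open import Data.Product.Base using (∃; ∃-syntax; _×_)
open import Data.Sum.Base using (_⊎_)
open import Data.Vec.Functional using (Vector; removeAt)
open import Function.Definitions using (Injective)
open import Level using (Level; 0ℓ; _⊔_) renaming (suc to lsuc)
open import Relation.Binary.Construct.Closure.ReflexiveTransitive using (Star)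
open import Relation.Binary.Core using (Rel)
open import Relation.Binary.Definitions using (Asymmetric; Decidable)
open import Relation.Binary.PropositionalEquality.Core using (_≡_; _≢_)
open import Relation.Binary.Structures using (IsStrictTotalOrder)
open import Relation.Nullary.Negation using (¬_)

record Digraph (n : ℕ) : Set₁ where
  field
    Arc  : Rel (Fin n) 0ℓ
    arc? : Decidable Arc

module _ {n : ℕ} (D : Digraph n) where
  open Digraph D

  Adj : Rel (Fin n) 0ℓ
  Adj u v = Arc u v ⊎ Arc v u

  Connected : Set
  Connected = ∀ u v → Star Adj u v

  -- A cycle v₀ v₁ … vₖ (v₀) is listed by its vertices, without repeating
  -- v₀ at the end; it has at least three of them.
  IsCycle : List (Fin n) → Set
  IsCycle []       = ⊥
  IsCycle (v ∷ vs) =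
    2 ≤ᴺ length vs × Unique (v ∷ vs) × Linked Adj (v ∷ vs ∷ʳ v)

  -- Adj does not record multiplicities, so cycles of length one (loops)
  -- and two (pairs of opposite arcs) are excluded by `asymmetric`.
  record IsDirectedTree : Set where
    field
      asymmetric : Asymmetric Arc
      connected  : Connected
      acyclic    : ∀ vs → ¬ IsCycle vs

  IsSource IsSink : Fin n → Set
  IsSource v = ∀ u → ¬ Arc u v
  IsSink   v = ∀ u → ¬ Arc v u

  record IsSwitchTree : Set where
    field
      isDirectedTree : IsDirectedTree
      sourceOrSink   : ∀ v → IsSource v ⊎ IsSink v

-- The plane is K × K for an arbitrary ordered field K with trichotomy, of
-- which ℝ (classically) and ℚ are instances.
record OrderedField c ℓ₁ ℓ₂ : Set (lsuc (c ⊔ ℓ₁ ⊔ ℓ₂)) where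
  infix  8 -_
  infixl 7 _*_
  infixl 6 _+_
  infix  4 _≈_ _<_
  field
    Carrier : Set c
    _≈_     : Rel Carrier ℓ₁
    _<_     : Rel Carrier ℓ₂
    _+_ _*_ : Op₂ Carrier
    -_      : Op₁ Carrier
    0# 1#   : Carrier
    isHeytingField     : IsHeytingField _≈_ (λ x y → ¬ (x ≈ y)) _+_ _*_ -_ 0# 1#
    isStrictTotalOrder : IsStrictTotalOrder _≈_ _<_
    +-monoˡ-<          : ∀ z {x y} → x < y → x + z < y + z
    *-pos              : ∀ {x y} → 0# < x → 0# < y → 0# < x * y

  infix 4 _≤_
  _≤_ : Rel Carrier (ℓ₁ ⊔ ℓ₂)
  x ≤ y = x < y ⊎ x ≈ y

  commutativeRing : CommutativeRing c ℓ₁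
  commutativeRing = record
    { isCommutativeRing = IsHeytingField.isCommutativeRing isHeytingField }

  open SemiringSum (CommutativeRing.semiring commutativeRing) public using (sum)
  open CommutativeRing commutativeRing public using (_-_)

module _ {c ℓ₁ ℓ₂ : Level} (K : OrderedField c ℓ₁ ℓ₂) where
  open OrderedField K

  record Point : Set c where
    constructor point
    field
      xcoord ycoord : Carrier

  open Point

  infix 4 _≈ₚ_
  _≈ₚ_ : Rel Point ℓ₁
  p ≈ₚ q = xcoord p ≈ xcoord q × ycoord p ≈ ycoord q

  InConvexHull : ∀ {m} → Vector Point m → Point → Set (c ⊔ ℓ₁ ⊔ ℓ₂)
  InConvexHull {m} Q p = ∃[ w ]
    (∀ i → 0# ≤ w i) ×
    sum w ≈ 1# ×
    p ≈ₚ point (sum λ (i : Fin m) → w i * xcoord (Q i))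
               (sum λ (i : Fin m) → w i * ycoord (Q i))

  -- A set of n + 1 points is given by an enumeration; `distinctHeights`
  -- makes the enumeration injective.
  record IsConvexPointSet {n : ℕ} (S : Vector Point (suc n)) :
                          Set (c ⊔ ℓ₁ ⊔ ℓ₂) where
    field
      distinctHeights : ∀ {i j} → i ≢ j → ¬ (ycoord (S i) ≈ ycoord (S j))
      convexPosition  : ∀ i → ¬ InConvexHull (removeAt S i) (S i)

  OnSegment : Point → Point → Point → Set (c ⊔ ℓ₁ ⊔ ℓ₂)
  OnSegment a b p = ∃[ t ]
    0# ≤ t × t ≤ 1# ×
    p ≈ₚ point ((1# - t) * xcoord a + t * xcoord b)
               ((1# - t) * ycoord a + t * ycoord b)

  -- φ v is the index in S of the image of the vertex v.
  record IsUPSE {n : ℕ} (D : Digraph n) (S : Vector Point n)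
                (φ : Fin n → Fin n) : Set (c ⊔ ℓ₁ ⊔ ℓ₂) where
    open Digraph D
    field
      injective : Injective _≡_ _≡_ φ
      upward    : ∀ {u v} → Arc u v → ycoord (S (φ u)) < ycoord (S (φ v))
      planar    : ∀ {u v u′ v′} → Arc u v → Arc u′ v′ →
                  ¬ (u ≡ u′ × v ≡ v′) →
                  ∀ p → OnSegment (S (φ u)) (S (φ v)) p →
                        OnSegment (S (φ u′)) (S (φ v′)) p →
                  ∃[ w ] (w ≡ u ⊎ w ≡ v) × (w ≡ u′ ⊎ w ≡ v′) × p ≈ₚ S (φ w)

  HasUPSE : ∀ {n} → Digraph n → Vector Point n → Set (c ⊔ ℓ₁ ⊔ ℓ₂)
  HasUPSE D S = ∃ (IsUPSE D S)

{-# OPTIONS --safe #-}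
-- Start at the topmost point and list the other points counterclockwise
-- around it. In this order the heights first decrease and then increase,
-- so the topmost point of every interval of points is one of its two ends,
-- and two chords cross if and only if their end-points alternate.
--
-- A tree with at least one arc is made of two trees joined by an arc from
-- a source t to a sink s. Place it into an interval of points by induction:
-- cut off, at the end holding the topmost point, an interval for the tree
-- of s, and leave the rest to the tree of t. Inductively s lies at the
-- topmost point of its interval, hence of the whole one, and no edge
-- passes over t or s within their own intervals. So the arc from t to s
-- goes up, crosses nothing, and again no edge passes over t or s.
module Submission where

open import Defs
open import Algebra.Apartness.Structures using (IsHeytingField)
open import Algebra.Bundles using (CommutativeRing)
import Algebra.Properties.AbelianGroup as AbelianGroupProperties
import Algebra.Properties.Ring as RingProperties
import Algebra.Properties.Semiring.Mult as SemiringMult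
import Algebra.Properties.Semiring.Sum as SemiringSum
import Algebra.Solver.Ring as RingSolver
open import Algebra.Solver.Ring.AlmostCommutativeRing
  using (fromCommutativeRing; _-Raw-AlmostCommutative⟶_)
open import Data.Empty using (⊥; ⊥-elim)
open import Data.Fin.Base using (Fin; zero; suc; punchIn; punchOut)
open import Data.Fin.Properties using (_≟_; punchIn-punchOut)
open import Data.Integer.Base as ℤ using (ℤ; +_; -[1+_]; _⊖_; _◃_)
import Data.Integer.Properties as ℤ
open import Data.List.Base
  using (List; []; _∷_; [_]; _++_; _∷ʳ_; length; allFin; initLast; _∷ʳ′_)
import Data.List.Membership.DecPropositional as DecMembership
open import Data.List.Membership.Propositional using (_∈_; _∉_)
open import Data.List.Membership.Propositional.Properties
  using (∈-++⁺ˡ; ∈-++⁺ʳ; ∈-++⁻; ∈-allFin)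
open import Data.List.Properties using (length-++; ++-assoc; ∷ʳ-injectiveʳ)
open import Data.List.Relation.Binary.Disjoint.Propositional using (Disjoint)
open import Data.List.Relation.Binary.Permutation.Propositional
  using (_↭_; ↭-refl; ↭-reflexive; ↭-sym; ↭-trans; prep; swap)
open import Data.List.Relation.Binary.Permutation.Propositional.Properties
  using (∈-resp-↭; All-resp-↭; ++-comm; ↭-length)
open import Data.List.Relation.Binary.Subset.Propositional using (_⊆_)
open import Data.List.Relation.Unary.All as All using (All; []; _∷_)
import Data.List.Relation.Unary.All.Properties as All
open import Data.List.Relation.Unary.AllPairs using (AllPairs; []; _∷_)
open import Data.List.Relation.Unary.Any using (here; there)
open import Data.List.Relation.Unary.Linked using (Linked; [-]; _∷_)
open import Data.List.Relation.Unary.Unique.Propositional using (Unique)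
import Data.List.Relation.Unary.Unique.Propositional.Properties as Unique
open import Data.Maybe.Base using (Maybe; just; nothing)
open import Data.Nat.Base as ℕ using (ℕ; zero; suc)
import Data.Nat.Properties as ℕ
open import Data.Product.Base as Product
  using (∃-syntax; ∃₂; _×_; _,_; proj₁; proj₂)
import Data.Sign.Base as Sign
open import Data.Sum.Base as Sum using (_⊎_; inj₁; inj₂; [_,_]′)
open import Data.Vec.Functional using (Vector; removeAt)
open import Function.Base using (_∘_; id)
open import Level using (_⊔_)
open import Relation.Binary.Construct.Closure.ReflexiveTransitive
  using (Star; ε; _◅_)
open import Relation.Binary.Core using (Rel)
open import Relation.Binary.Definitions
  using (Asymmetric; Transitive; tri<; tri≈; tri>)
open import Relation.Binary.PropositionalEquality as ≡ using (_≡_; _≢_)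
open import Relation.Binary.Structures using (IsStrictTotalOrder)
open import Relation.Nullary.Decidable using (Dec; yes; no; _⊎-dec_)
open import Relation.Nullary.Negation using (¬_; contradiction)

-- Spanning trees assembled from rooted trees

module _ {n : ℕ} (D : Digraph n) where
  open Digraph D
  open import Data.Nat.Base using (_+_; _≤_; z≤n; s≤s)
  open ≡ using (refl; sym; trans; cong; subst; subst₂)
  open DecMembership (_≟_ {n}) using (_∈?_)

  private
    variable
      r c u v w x y : Fin n
      xs ys zs : List (Fin n)

  Adj-sym : Adj D u v → Adj D v u
  Adj-sym = Sum.swap

  -- A tree is encoded by the way it is assembled: `join` links the roots of two disjoint trees and
  -- keeps the first root. The induction in `layout` follows these joins. Only the linking edges are
  -- recorded; that there are no others between the halves comes from acyclicity.
  data Rooted : Fin n → List (Fin n) → Set where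
    leaf : ∀ r → Rooted r [ r ]
    join : Rooted r xs → Rooted c ys → Adj D r c → Disjoint xs ys →
           Rooted r (xs ++ ys)

  root∈ : Rooted r xs → r ∈ xs
  root∈ (leaf r)       = here refl
  root∈ (join t _ _ _) = ∈-++⁺ˡ (root∈ t)

  Rooted-unique : Rooted r xs → Unique xs
  Rooted-unique (leaf r)       = [] ∷ []
  Rooted-unique (join s t _ d) =
    Unique.++⁺ (Rooted-unique s) (Rooted-unique t) d

  -- Descend into the half that contains `u` until `u` is a leaf, and join `v` there. The new vertex
  -- may land in the middle of the list, hence the two inclusions.
  attach : Rooted r xs → u ∈ xs → Adj D u v → v ∉ xs →
           ∃[ ys ] Rooted r ys × (ys ⊆ v ∷ xs) × (v ∷ xs ⊆ ys)
  attach {v = v} (leaf r) (here refl) uv v∉ =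
    _ , join (leaf r) (leaf v) uv (λ { (here refl , here refl) → v∉ (here refl) }) ,
    (λ { (here refl) → there (here refl) ; (there (here refl)) → here refl }) ,
    (λ { (here refl) → there (here refl) ; (there (here refl)) → here refl })
  attach {v = v} (join {xs = xs} {ys = ys} s t rc d) u∈ uv v∉ with ∈-++⁻ xs u∈
  ... | inj₁ u∈xs with attach s u∈xs uv (v∉ ∘ ∈-++⁺ˡ)
  ...   | zs , s′ , zs⊆ , ⊆zs =
    _ , join s′ t rc disj , sub , sup
    where
    disj : Disjoint zs ys
    disj (z∈ , z∈ys) with zs⊆ z∈
    ... | here refl  = v∉ (∈-++⁺ʳ xs z∈ys)
    ... | there z∈xs = d (z∈xs , z∈ys)
    sub : zs ++ ys ⊆ v ∷ xs ++ ys
    sub z∈ with ∈-++⁻ zs z∈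
    ... | inj₁ z∈zs = ∈-++⁺ˡ {xs = v ∷ xs} (zs⊆ z∈zs)
    ... | inj₂ z∈ys = there (∈-++⁺ʳ xs z∈ys)
    sup : v ∷ xs ++ ys ⊆ zs ++ ys
    sup z∈ with ∈-++⁻ (v ∷ xs) z∈
    ... | inj₁ z∈xs = ∈-++⁺ˡ (⊆zs z∈xs)
    ... | inj₂ z∈ys = ∈-++⁺ʳ zs z∈ys
  attach {v = v} (join {xs = xs} {ys = ys} s t rc d) u∈ uv v∉ | inj₂ u∈ys
    with attach t u∈ys uv (v∉ ∘ ∈-++⁺ʳ xs)
  ...   | zs , t′ , zs⊆ , ⊆zs =
    _ , join s t′ rc disj , sub , sup
    where
    disj : Disjoint xs zs
    disj (z∈xs , z∈) with zs⊆ z∈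
    ... | here refl  = v∉ (∈-++⁺ˡ z∈xs)
    ... | there z∈ys = d (z∈xs , z∈ys)
    sub : xs ++ zs ⊆ v ∷ xs ++ ys
    sub z∈ with ∈-++⁻ xs z∈
    ... | inj₁ z∈xs = there (∈-++⁺ˡ z∈xs)
    ... | inj₂ z∈zs with zs⊆ z∈zs
    ...   | here refl  = here refl
    ...   | there z∈ys = there (∈-++⁺ʳ xs z∈ys)
    sup : v ∷ xs ++ ys ⊆ xs ++ zs
    sup (here refl) = ∈-++⁺ʳ xs (⊆zs (here refl))
    sup (there z∈) with ∈-++⁻ xs z∈
    ... | inj₁ z∈xs = ∈-++⁺ˡ z∈xs
    ... | inj₂ z∈ys = ∈-++⁺ʳ xs (⊆zs (there z∈ys))

  -- Follow the walk from `u`: whenever it leaves the tree, the vertex it enters is adjacent to a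
  -- tree vertex and can be attached.
  grow : Rooted r xs → u ∈ xs → Star (Adj D) u w →
         ∃[ ys ] Rooted r ys × (xs ⊆ ys) × w ∈ ys
  grow t u∈ ε = _ , t , id , u∈
  grow {xs = xs} t u∈ (_◅_ {j = v} uv vw) with v ∈? xs
  ... | yes v∈ = grow t v∈ vw
  ... | no  v∉ =
    let _ , t′ , _ , ⊆ys  = attach t u∈ uv v∉
        _ , t″ , ys⊆ , w∈ = grow t′ (⊆ys (here refl)) vw
    in  _ , t″ , ys⊆ ∘ ⊆ys ∘ there , w∈

  spanningTree : Connected D → ∀ r → ∃[ xs ] Rooted r xs × (∀ v → v ∈ xs)
  spanningTree conn r =
    let xs , t , all⊆ = cover (allFin n) in xs , t , λ v → all⊆ (∈-allFin v)
    where
    cover : ∀ ws → ∃[ xs ] Rooted r xs × (ws ⊆ xs)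
    cover []       = _ , leaf r , λ ()
    cover (w ∷ ws) =
      let _ , t , ws⊆       = cover ws
          _ , t′ , ⊆xs , w∈ = grow t (root∈ t) (conn r w)
      in  _ , t′ , λ { (here refl) → w∈ ; (there z∈) → ⊆xs (ws⊆ z∈) }

  -- Paths and cycles

  infixr 5 _∷_
  data Path : Fin n → Fin n → List (Fin n) → Set where
    end : ∀ x → Path x x [ x ]
    _∷_ : Adj D x y → Path y v xs → Path x v (x ∷ xs)

  Path-++ : Path u v xs → Adj D v x → Path x y ys → Path u y (xs ++ ys)
  Path-++ (end _)  vx q = vx ∷ q
  Path-++ (uw ∷ p) vx q = uw ∷ Path-++ p vx q

  Path⇒Linked : Path u v xs → Adj D v w → Linked (Adj D) (xs ∷ʳ w)
  Path⇒Linked (end _)          vw = vw ∷ [-]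
  Path⇒Linked (ux ∷ end _)     vw = ux ∷ vw ∷ [-]
  Path⇒Linked (ux ∷ p@(_ ∷ _)) vw = ux ∷ Path⇒Linked p vw

  -- Between different halves, go to the root of the one, over the joining edge, and on from the
  -- root of the other. Keeping the path inside `xs` makes disjointness of the halves yield
  -- uniqueness.
  path : Rooted r xs → x ∈ xs → y ∈ xs →
         ∃[ ws ] Path x y ws × Unique ws × (ws ⊆ xs)
  path (leaf r) (here refl) (here refl) = _ , end r , [] ∷ [] , id
  path (join {xs = xs} s t rc d) x∈ y∈ with ∈-++⁻ xs x∈ | ∈-++⁻ xs y∈
  ... | inj₁ x∈xs | inj₁ y∈xs =
    let _ , p , p! , p⊆ = path s x∈xs y∈xs in _ , p , p! , ∈-++⁺ˡ ∘ p⊆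
  ... | inj₂ x∈ys | inj₂ y∈ys =
    let _ , p , p! , p⊆ = path t x∈ys y∈ys in _ , p , p! , ∈-++⁺ʳ xs ∘ p⊆
  ... | inj₁ x∈xs | inj₂ y∈ys =
    let ws , p , p! , p⊆ = path s x∈xs (root∈ s)
        _  , q , q! , q⊆ = path t (root∈ t) y∈ys
    in  _ , Path-++ p rc q ,
        Unique.++⁺ p! q! (λ (z∈p , z∈q) → d (p⊆ z∈p , q⊆ z∈q)) ,
        [ ∈-++⁺ˡ ∘ p⊆ , ∈-++⁺ʳ xs ∘ q⊆ ]′ ∘ ∈-++⁻ ws
  ... | inj₂ x∈ys | inj₁ y∈xs =
    let ws , q , q! , q⊆ = path t x∈ys (root∈ t)
        _  , p , p! , p⊆ = path s (root∈ s) y∈xs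
    in  _ , Path-++ q (Adj-sym rc) p ,
        Unique.++⁺ q! p! (λ (z∈q , z∈p) → d (p⊆ z∈p , q⊆ z∈q)) ,
        [ ∈-++⁺ʳ xs ∘ q⊆ , ∈-++⁺ˡ ∘ p⊆ ]′ ∘ ∈-++⁻ ws

  Path-length : Path u v xs → 1 ≤ length xs
  Path-length (end _) = s≤s z≤n
  Path-length (_ ∷ _) = s≤s z≤n

  Path-length-≢ : u ≢ v → Path u v xs → 2 ≤ length xs
  Path-length-≢ u≢v (end _) = contradiction refl u≢v
  Path-length-≢ u≢v (_ ∷ p) = s≤s (Path-length p)

  Path⇒IsCycle : Path u v xs → Adj D v u → Unique xs → 3 ≤ length xs →
                 IsCycle D xs
  Path⇒IsCycle (end _)   _  _   (s≤s ())
  Path⇒IsCycle p@(_ ∷ _) vu xs! (s≤s 2≤) = 2≤ , xs! , Path⇒Linked p vu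

  -- A second edge xy between the two halves would close a cycle through rc.
  crossEdge : (∀ vs → ¬ IsCycle D vs) →
              Rooted r xs → Rooted c ys → Adj D r c → Disjoint xs ys →
              x ∈ xs → y ∈ ys → Adj D x y → x ≡ r × y ≡ c
  crossEdge {r = r} {c = c} {x = x} {y = y} acyclic s t rc d x∈ y∈ xy
    with path s x∈ (root∈ s) | path t (root∈ t) y∈
  ... | ws , p , p! , p⊆ | zs , q , q! , q⊆ = go (x ≟ r) (c ≟ y)
    where
    -- The two paths together with `rc` and `xy` close up to a cycle as soon as they have three
    -- vertices, so each of them is a single vertex.
    long : ¬ 3 ≤ length ws + length zs
    long 3≤ = acyclic _ (Path⇒IsCycle (Path-++ p rc q) (Adj-sym xy)
      (Unique.++⁺ p! q! λ (z∈p , z∈q) → d (p⊆ z∈p , q⊆ z∈q))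
      (subst (3 ≤_) (sym (length-++ ws)) 3≤))
    go : Dec (x ≡ r) → Dec (c ≡ y) → x ≡ r × y ≡ c
    go (yes x≡r) (yes c≡y) = x≡r , sym c≡y
    go (no x≢r)  _         =
      contradiction (ℕ.+-mono-≤ (Path-length-≢ x≢r p) (Path-length q)) long
    go (yes _)   (no c≢y)  =
      contradiction (ℕ.+-mono-≤ (Path-length p) (Path-length-≢ c≢y q)) long

  -- Intervals of points and their top ends

  module Layouts
    {p ℓ₁ ℓ₂} {P : Set p} (_≺_ : Rel P ℓ₁) (_⊏_ : Rel P ℓ₂)
    (≺-asym       : Asymmetric _≺_)
    (⊏-trans      : Transitive _⊏_)
    (≺⇒comparable : ∀ {p q} → p ≺ q → p ⊏ q ⊎ q ⊏ p)
    (valley       : ∀ {p q o} → p ≺ q → q ≺ o → q ⊏ p ⊎ q ⊏ o)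
    where

    private
      variable
        o q t : P
        ps qs os : List P
        φ χ ψ : Fin n → P

    ≺-irrefl : ¬ q ≺ q
    ≺-irrefl q≺q = ≺-asym q≺q q≺q

    Ordered : List P → Set _
    Ordered = AllPairs _≺_

    IsTop : List P → P → Set _
    IsTop ps t = ∀ {p} → p ∈ ps → p ≡ t ⊎ p ⊏ t

    -- Both orders occur, since the top point may be at either end of an interval.
    Separated : List P → List P → Set _
    Separated ps qs = (∀ {p q} → p ∈ ps → q ∈ qs → p ≺ q) ⊎
                      (∀ {p q} → p ∈ ps → q ∈ qs → q ≺ p)

    Separated-sym : Separated ps qs → Separated qs ps
    Separated-sym (inj₁ ps≺qs) = inj₂ λ q∈ p∈ → ps≺qs p∈ q∈
    Separated-sym (inj₂ qs≺ps) = inj₁ λ q∈ p∈ → qs≺ps p∈ q∈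

    Separated⇒∉ : Separated ps qs → q ∈ ps → q ∉ qs
    Separated⇒∉ (inj₁ ps≺qs) q∈ps q∈qs = ≺-irrefl (ps≺qs q∈ps q∈qs)
    Separated⇒∉ (inj₂ qs≺ps) q∈ps q∈qs = ≺-irrefl (qs≺ps q∈ps q∈qs)

    -- Used in `glue`: an edge within one half never passes over a point of the other half.
    noneBetween : Separated ps qs → ∀ {p} → p ∈ ps → q ∈ qs → o ∈ ps →
                  p ≺ q → ¬ q ≺ o
    noneBetween (inj₁ ps≺qs) _  q∈ o∈ _   q≺o = ≺-asym q≺o (ps≺qs o∈ q∈)
    noneBetween (inj₂ qs≺ps) p∈ q∈ _  p≺q _   = ≺-asym p≺q (qs≺ps p∈ q∈)

    AllPairs-++⁻ : ∀ ps → Ordered (ps ++ qs) →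
                   Ordered ps × Ordered qs ×
                   (∀ {p q} → p ∈ ps → q ∈ qs → p ≺ q)
    AllPairs-++⁻ []       qs!         = [] , qs! , λ ()
    AllPairs-++⁻ (p ∷ ps) (p≺ ∷ psqs!) =
      let ps! , qs! , ps≺qs = AllPairs-++⁻ ps psqs!
      in  All.++⁻ˡ ps p≺ ∷ ps! , qs! ,
          λ { (here refl) q∈ → All.lookup (All.++⁻ʳ ps p≺) q∈
            ; (there p∈)  q∈ → ps≺qs p∈ q∈ }

    TopAtEnd : P → List P → Set _
    TopAtEnd p ps = IsTop (p ∷ ps) p ⊎
                    ∃₂ λ qs q → p ∷ ps ≡ qs ∷ʳ q × IsTop (p ∷ ps) q

    -- By `valley` every inner point is lower than one of the two ends, hence lower than the higher
    -- end.
    topAtEnd : ∀ p ps → Ordered (p ∷ ps) → TopAtEnd p ps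
    topAtEnd p ps (p≺ ∷ ps!) with initLast ps
    ... | []       = inj₁ λ { (here refl) → inj₁ refl }
    ... | qs ∷ʳ′ q = ends (≺⇒comparable (All.lookup p≺ (∈-++⁺ʳ qs (here refl))))
      where
      inner : o ∈ qs → o ⊏ p ⊎ o ⊏ q
      inner o∈ = valley (All.lookup p≺ (∈-++⁺ˡ o∈))
                        (proj₂ (proj₂ (AllPairs-++⁻ qs ps!)) o∈ (here refl))
      ends : p ⊏ q ⊎ q ⊏ p → TopAtEnd p (qs ∷ʳ q)
      ends (inj₁ p⊏q) = inj₂ (p ∷ qs , q , refl , top)
        where
        top : IsTop (p ∷ qs ∷ʳ q) q
        top (here refl) = inj₂ p⊏q
        top (there o∈) with ∈-++⁻ qs o∈
        ... | inj₁ o∈qs        = inj₂ ([ (λ o⊏p → ⊏-trans o⊏p p⊏q) , id ]′ (inner o∈qs))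
        ... | inj₂ (here refl) = inj₁ refl
      ends (inj₂ q⊏p) = inj₁ top
        where
        top : IsTop (p ∷ qs ∷ʳ q) p
        top (here refl) = inj₁ refl
        top (there o∈) with ∈-++⁻ qs o∈
        ... | inj₁ o∈qs        = inj₂ ([ id , (λ o⊏q → ⊏-trans o⊏q q⊏p) ]′ (inner o∈qs))
        ... | inj₂ (here refl) = inj₂ q⊏p

    splitAt-length : ∀ k l (ps : List P) → length ps ≡ k + l →
                     ∃₂ λ qs os → ps ≡ qs ++ os × length qs ≡ k × length os ≡ l
    splitAt-length zero    l ps       len = [] , ps , refl , refl , len
    splitAt-length (suc k) l (p ∷ ps) len =
      let qs , os , eq , lq , lo = splitAt-length k l ps (ℕ.suc-injective len)
      in  p ∷ qs , os , cong (p ∷_) eq , cong suc lq , lo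

    -- A permutation, not an equality, relates `upper ++ lower` to `ps`, because `upper` may be cut
    -- off on the right.
    record Split (ps : List P) (k l : ℕ) : Set (p ⊔ ℓ₁ ⊔ ℓ₂) where
      field
        upper lower  : List P
        upper-length : length upper ≡ k
        lower-length : length lower ≡ l
        upper!       : Ordered upper
        lower!       : Ordered lower
        separated    : Separated upper lower
        upper++lower : upper ++ lower ↭ ps
        top          : P
        top∈upper    : top ∈ upper
        isTop        : IsTop ps top

      upper⊆ : upper ⊆ ps
      upper⊆ = ∈-resp-↭ upper++lower ∘ ∈-++⁺ˡ

      lower⊆ : lower ⊆ ps
      lower⊆ = ∈-resp-↭ upper++lower ∘ ∈-++⁺ʳ upper

      -- The top point of the whole interval belongs to `upper`, so `t` is at least as high, and `q`
      -- differs from it by separation.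
      lower⊏ : IsTop upper t → q ∈ lower → q ⊏ t
      lower⊏ t-top q∈ with isTop (lower⊆ q∈) | t-top top∈upper
      ... | inj₁ refl  | _          = contradiction q∈ (Separated⇒∉ separated top∈upper)
      ... | inj₂ q⊏top | inj₁ refl  = q⊏top
      ... | inj₂ q⊏top | inj₂ top⊏t = ⊏-trans q⊏top top⊏t

      upper-IsTop : IsTop upper t → IsTop ps t
      upper-IsTop t-top q∈ with ∈-++⁻ upper (∈-resp-↭ (↭-sym upper++lower) q∈)
      ... | inj₁ q∈upper = t-top q∈upper
      ... | inj₂ q∈lower = inj₂ (lower⊏ t-top q∈lower)

    -- Cut at the end given by `topAtEnd`. The length `suc k` makes the part cut off there nonempty,
    -- so that it contains this end.
    split : ∀ k l → Ordered ps → length ps ≡ suc k + l → Split ps (suc k) l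
    split {ps = p ∷ ps} k l ps! len with topAtEnd p ps ps!
    ... | inj₁ p-top with splitAt-length (suc k) l (p ∷ ps) len
    ...   | _ ∷ qs , os , refl , lq , lo =
      let qs! , os! , qs≺os = AllPairs-++⁻ (p ∷ qs) ps!
      in  record
        { upper-length = lq ; lower-length = lo ; upper! = qs! ; lower! = os!
        ; separated = inj₁ qs≺os ; upper++lower = ↭-refl
        ; top∈upper = here refl ; isTop = p-top }
    split {ps = p ∷ ps} k l ps! len | inj₂ (ms , q , eq , q-top)
      with splitAt-length l (suc k) (p ∷ ps) (trans len (ℕ.+-comm (suc k) l))
    ... | os , qs , eq′ , lo , lq with initLast qs
    ...   | qs′ ∷ʳ′ q′ =
      let os! , qs! , os≺qs = AllPairs-++⁻ os (subst Ordered eq′ ps!)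
          -- Both are the last element of `p ∷ ps`, so the top point lies in the right part.
          q≡q′ = ∷ʳ-injectiveʳ ms (os ++ qs′)
                   (trans (sym eq) (trans eq′ (sym (++-assoc os qs′ _))))
      in  record
        { upper-length = lq ; lower-length = lo ; upper! = qs! ; lower! = os!
        ; separated = inj₂ λ q∈ o∈ → os≺qs o∈ q∈
        ; upper++lower = ↭-trans (++-comm (qs′ ∷ʳ q′) os) (↭-reflexive (sym eq′))
        ; top∈upper = ∈-++⁺ʳ qs′ (here q≡q′) ; isTop = q-top }

    -- The map is total but constrained on `xs` only. In `nocross` one pattern of alternating ends
    -- suffices, because edges are taken in both directions. `visible` strengthens the induction: it
    -- leaves room for an edge at the root, which the next join adds.
    record Layout (r : Fin n) (xs : List (Fin n)) (ps : List P)
                  (φ : Fin n → P) : Set (p ⊔ ℓ₁ ⊔ ℓ₂) where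
      field
        into    : v ∈ xs → φ v ∈ ps
        inj     : u ∈ xs → v ∈ xs → φ u ≡ φ v → u ≡ v
        up      : u ∈ xs → v ∈ xs → Arc u v → φ u ⊏ φ v
        nocross : u ∈ xs → v ∈ xs → x ∈ xs → y ∈ xs → Adj D u v → Adj D x y →
                  φ u ≺ φ x → φ x ≺ φ v → ¬ φ v ≺ φ y
        visible : u ∈ xs → v ∈ xs → Adj D u v → φ u ≺ φ r → ¬ φ r ≺ φ v

    -- The layouts of two halves come with different maps; this restates each for the map that
    -- combines them.
    Layout-cong : r ∈ xs → (∀ {v} → v ∈ xs → φ v ≡ χ v) →
                  Layout r xs ps φ → Layout r xs ps χ
    Layout-cong {ps = ps} r∈ φ≡χ L = record
      { into    = λ v∈ → subst (_∈ ps) (φ≡χ v∈) (into v∈)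
      ; inj     = λ u∈ v∈ eq → inj u∈ v∈ (trans (φ≡χ u∈) (trans eq (sym (φ≡χ v∈))))
      ; up      = λ u∈ v∈ uv → subst₂ _⊏_ (φ≡χ u∈) (φ≡χ v∈) (up u∈ v∈ uv)
      ; nocross = λ u∈ v∈ x∈ y∈ uv xy u≺x x≺v v≺y →
          nocross u∈ v∈ x∈ y∈ uv xy (back u∈ x∈ u≺x) (back x∈ v∈ x≺v) (back v∈ y∈ v≺y)
      ; visible = λ u∈ v∈ uv u≺r r≺v →
          visible u∈ v∈ uv (back u∈ r∈ u≺r) (back r∈ v∈ r≺v)
      }
      where
      open Layout L
      back = λ {u v} u∈ v∈ → subst₂ _≺_ (sym (φ≡χ {u} u∈)) (sym (φ≡χ {v} v∈))

    -- Layouts of switch-trees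

    module _ (isSwitchTree : IsSwitchTree D) where
      open IsSwitchTree isSwitchTree
      open IsDirectedTree isDirectedTree

      -- By `crossEdge` every edge lies in one half or is the joining edge. Alternation of two edges
      -- would put a point of one interval between two points of the other, or put a root under an
      -- edge of its own half, or repeat a conflict that the given layouts exclude.
      glue : Rooted r xs → Rooted c ys → (rc : Adj D r c) → Disjoint xs ys →
             Layout r xs ps χ → Layout c ys qs χ → Separated ps qs →
             ps ⊆ os → qs ⊆ os →
             (Arc r c → χ r ⊏ χ c) → (Arc c r → χ c ⊏ χ r) →
             Layout r (xs ++ ys) os χ
      glue {r = r} {xs = xs} {c = c} {ys = ys} {ps = ps} {χ = χ} {qs = qs}
           s t rc d L M sep ps⊆ qs⊆ r⊏c c⊏r = record
        { into = [ ps⊆ ∘ L.into , qs⊆ ∘ M.into ]′ ∘ ∈-++⁻ xs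
        ; inj = inj ; up = up ; nocross = nocross ; visible = visible }
        where
        module L = Layout L
        module M = Layout M

        inj : u ∈ xs ++ ys → v ∈ xs ++ ys → χ u ≡ χ v → u ≡ v
        inj u∈ v∈ eq with ∈-++⁻ xs u∈ | ∈-++⁻ xs v∈
        ... | inj₁ u∈ | inj₁ v∈ = L.inj u∈ v∈ eq
        ... | inj₂ u∈ | inj₂ v∈ = M.inj u∈ v∈ eq
        ... | inj₁ u∈ | inj₂ v∈ =
          contradiction (M.into v∈) (Separated⇒∉ sep (subst (_∈ _) eq (L.into u∈)))
        ... | inj₂ u∈ | inj₁ v∈ =
          contradiction (M.into u∈) (Separated⇒∉ sep (subst (_∈ _) (sym eq) (L.into v∈)))

        data Edge : Fin n → Fin n → Set where
          inl : u ∈ xs → v ∈ xs → Edge u v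
          inr : u ∈ ys → v ∈ ys → Edge u v
          r-c : Edge r c
          c-r : Edge c r

        edge : u ∈ xs ++ ys → v ∈ xs ++ ys → Adj D u v → Edge u v
        edge u∈ v∈ uv with ∈-++⁻ xs u∈ | ∈-++⁻ xs v∈
        ... | inj₁ u∈ | inj₁ v∈ = inl u∈ v∈
        ... | inj₂ u∈ | inj₂ v∈ = inr u∈ v∈
        ... | inj₁ u∈ | inj₂ v∈ with crossEdge acyclic s t rc d u∈ v∈ uv
        ...   | refl , refl = r-c
        edge _ _ uv | inj₂ u∈ | inj₁ v∈
          with crossEdge acyclic s t rc d v∈ u∈ (Adj-sym uv)
        ...   | refl , refl = c-r

        up : u ∈ xs ++ ys → v ∈ xs ++ ys → Arc u v → χ u ⊏ χ v
        up u∈ v∈ uv with edge u∈ v∈ (inj₁ uv)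
        ... | inl u∈ v∈ = L.up u∈ v∈ uv
        ... | inr u∈ v∈ = M.up u∈ v∈ uv
        ... | r-c       = r⊏c uv
        ... | c-r       = c⊏r uv

        r∈ = L.into (root∈ s)
        c∈ = M.into (root∈ t)
        xs∌ : ∀ {p q o} → p ∈ ps → q ∈ qs → o ∈ ps → p ≺ q → ¬ q ≺ o
        xs∌ = noneBetween sep
        ys∌ : ∀ {p q o} → p ∈ qs → q ∈ ps → o ∈ qs → p ≺ q → ¬ q ≺ o
        ys∌ = noneBetween (Separated-sym sep)

        visible : u ∈ xs ++ ys → v ∈ xs ++ ys → Adj D u v → χ u ≺ χ r → ¬ χ r ≺ χ v
        visible u∈ v∈ uv u≺r r≺v with edge u∈ v∈ uv
        ... | inl u∈ v∈ = L.visible u∈ v∈ uv u≺r r≺v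
        ... | inr u∈ v∈ = ys∌ (M.into u∈) r∈ (M.into v∈) u≺r r≺v
        ... | r-c       = ≺-irrefl u≺r
        ... | c-r       = ≺-irrefl r≺v

        nocross : u ∈ xs ++ ys → v ∈ xs ++ ys → x ∈ xs ++ ys → y ∈ xs ++ ys →
                  Adj D u v → Adj D x y → χ u ≺ χ x → χ x ≺ χ v → ¬ χ v ≺ χ y
        nocross u∈ v∈ x∈ y∈ uv xy u≺x x≺v v≺y with edge u∈ v∈ uv | edge x∈ y∈ xy
        ... | inl u∈ v∈ | inl x∈ y∈ = L.nocross u∈ v∈ x∈ y∈ uv xy u≺x x≺v v≺y
        ... | inl u∈ v∈ | inr x∈ y∈ = xs∌ (L.into u∈) (M.into x∈) (L.into v∈) u≺x x≺v
        ... | inl u∈ v∈ | r-c       = L.visible u∈ v∈ uv u≺x x≺v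
        ... | inl u∈ v∈ | c-r       = xs∌ (L.into u∈) c∈ (L.into v∈) u≺x x≺v
        ... | inr u∈ v∈ | inl x∈ y∈ = ys∌ (M.into u∈) (L.into x∈) (M.into v∈) u≺x x≺v
        ... | inr u∈ v∈ | inr x∈ y∈ = M.nocross u∈ v∈ x∈ y∈ uv xy u≺x x≺v v≺y
        ... | inr u∈ v∈ | r-c       = ys∌ (M.into u∈) r∈ (M.into v∈) u≺x x≺v
        ... | inr u∈ v∈ | c-r       = M.visible u∈ v∈ uv u≺x x≺v
        ... | r-c       | inl x∈ y∈ = xs∌ (L.into x∈) c∈ (L.into y∈) x≺v v≺y
        ... | r-c       | inr x∈ y∈ = M.visible x∈ y∈ xy x≺v v≺y
        ... | r-c       | r-c       = ≺-irrefl u≺x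
        ... | r-c       | c-r       = ≺-irrefl x≺v
        ... | c-r       | inl x∈ y∈ = L.visible x∈ y∈ xy x≺v v≺y
        ... | c-r       | inr x∈ y∈ = ys∌ (M.into x∈) r∈ (M.into y∈) x≺v v≺y
        ... | c-r       | r-c       = ≺-irrefl x≺v
        ... | c-r       | c-r       = ≺-irrefl u≺x

      -- The equation for the root lets `layout` carry over its position at the top.
      join-layout : Rooted r xs → Rooted c ys → Adj D r c → Disjoint xs ys →
                    Layout r xs ps φ → Layout c ys qs ψ → Separated ps qs →
                    ps ⊆ os → qs ⊆ os →
                    (Arc r c → φ r ⊏ ψ c) → (Arc c r → ψ c ⊏ φ r) →
                    ∃[ χ ] Layout r (xs ++ ys) os χ × φ r ≡ χ r
      join-layout {xs = xs} {ys = ys} {φ = φ} {ψ = ψ}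
                  s t rc d L M sep ps⊆ qs⊆ r⊏c c⊏r =
        glued , glue s t rc d (Layout-cong (root∈ s) φ≡ L) (Layout-cong (root∈ t) ψ≡ M)
              sep ps⊆ qs⊆
              (subst₂ _⊏_ (φ≡ (root∈ s)) (ψ≡ (root∈ t)) ∘ r⊏c)
              (subst₂ _⊏_ (ψ≡ (root∈ t)) (φ≡ (root∈ s)) ∘ c⊏r) ,
        φ≡ (root∈ s)
        where
        glued : Fin n → P
        glued v with v ∈? xs
        ... | yes _ = φ v
        ... | no  _ = ψ v
        φ≡ : v ∈ xs → φ v ≡ glued v
        φ≡ {v} v∈ with v ∈? xs
        ... | yes _ = refl
        ... | no v∉ = contradiction v∈ v∉
        ψ≡ : v ∈ ys → ψ v ≡ glued v
        ψ≡ {v} v∈ with v ∈? xs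
        ... | yes v∈xs = contradiction (v∈xs , v∈) d
        ... | no _     = refl

      -- The switch property enters here: it lets the induction place the head of the joining arc at
      -- the top of its interval.
      Arc⇒IsSink : Arc u v → IsSink D v
      Arc⇒IsSink {v = v} uv with sourceOrSink v
      ... | inj₁ source = contradiction uv (source _)
      ... | inj₂ sink   = sink

      -- The root provides the positive length that `split` asks for.
      split-Rooted : Rooted r xs → Ordered ps → length ps ≡ length xs + length ys →
                     Split ps (length xs) (length ys)
      split-Rooted {xs = _ ∷ _} _ ps! len = split _ _ ps! len
      split-Rooted {xs = []}    t ps! len with () ← root∈ t

      -- The half of the arc's head goes into `upper`. The head is a sink, so it is on top there,
      -- and thus above the tail, which lies in `lower`. If the root is the head, it is on top of
      -- all of `ps`; if it is the tail, it is no sink and the last clause is vacuous.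
      layout : Rooted r xs → ∀ ps → Ordered ps → length ps ≡ length xs →
               ∃[ φ ] Layout r xs ps φ × (IsSink D r → IsTop ps (φ r))
      layout (leaf r) (p ∷ []) _ _ = (λ _ → p) , record
        { into    = λ _ → here refl
        ; inj     = λ { (here refl) (here refl) _ → refl }
        ; up      = λ { (here refl) (here refl) rr → contradiction rr (asymmetric rr) }
        ; nocross = λ _ _ _ _ _ _ p≺p _ _ → ≺-irrefl p≺p
        ; visible = λ _ _ _ p≺p _ → ≺-irrefl p≺p
        } , λ _ → λ { (here refl) → inj₁ refl }
      layout (join {xs = xs} {ys = ys} s t rc@(inj₁ r→c) d) ps ps! len =
        proj₁ J , proj₁ (proj₂ J) , λ sink → contradiction r→c (sink _)
        where
        sp = split-Rooted {ys = xs} t ps!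
               (trans len (trans (length-++ xs) (ℕ.+-comm (length xs) (length ys))))
        open Split sp
        S = layout s lower lower! lower-length
        T = layout t upper upper! upper-length
        c-top = proj₂ (proj₂ T) (Arc⇒IsSink r→c)
        J = join-layout s t rc d (proj₁ (proj₂ S)) (proj₁ (proj₂ T))
              (Separated-sym separated) lower⊆ upper⊆
              (λ _ → lower⊏ c-top (Layout.into (proj₁ (proj₂ S)) (root∈ s)))
              (λ c→r → contradiction c→r (asymmetric r→c))
      layout (join {xs = xs} {ys = ys} s t rc@(inj₂ c→r) d) ps ps! len =
        proj₁ J , proj₁ (proj₂ J) ,
        λ _ → subst (IsTop ps) (proj₂ (proj₂ J)) (upper-IsTop r-top)
        where
        sp = split-Rooted {ys = ys} s ps! (trans len (length-++ xs))
        open Split sp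
        S = layout s upper upper! upper-length
        T = layout t lower lower! lower-length
        r-top = proj₂ (proj₂ S) (Arc⇒IsSink c→r)
        J = join-layout s t rc d (proj₁ (proj₂ S)) (proj₁ (proj₂ T))
              separated upper⊆ lower⊆
              (λ r→c → contradiction r→c (asymmetric c→r))
              (λ _ → lower⊏ r-top (Layout.into (proj₁ (proj₂ T)) (root∈ t)))

-- Integer coefficients for ring identities

-- The ring solver needs coefficients with decidable equality to cancel
-- terms, hence ℤ rather than the ring itself.
module IntegerCoefficients {c ℓ} (R : CommutativeRing c ℓ) where
  open CommutativeRing R
  open RingProperties ring using (-‿distribˡ-*; -‿distribʳ-*; -0#≈0#; -‿involutive)
  open AbelianGroupProperties +-abelianGroup using (⁻¹-∙-comm)
  open SemiringMult semiring using (×-homo-+; ×1-homo-*; ×-homo-1)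
    renaming (_×_ to infixr 8 _·_)
  open import Relation.Binary.Reasoning.Setoid setoid

  fromℤ : ℤ → Carrier
  fromℤ (+ n)    = n · 1#
  fromℤ -[1+ n ] = - (suc n · 1#)

  private
    cancel-1+ : ∀ x y → (1# + x) - (1# + y) ≈ x - y
    cancel-1+ x y = begin
      (1# + x) + - (1# + y)     ≈⟨ +-cong (+-comm 1# x) (sym (⁻¹-∙-comm 1# y)) ⟩
      (x + 1#) + (- 1# + - y)   ≈⟨ +-assoc x 1# _ ⟩
      x + (1# + (- 1# + - y))   ≈⟨ +-congˡ (+-assoc 1# (- 1#) (- y)) ⟨
      x + ((1# + - 1#) + - y)   ≈⟨ +-congˡ (+-congʳ (-‿inverseʳ 1#)) ⟩
      x + (0# + - y)            ≈⟨ +-congˡ (+-identityˡ (- y)) ⟩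
      x - y                     ∎

  fromℤ-⊖ : ∀ m n → fromℤ (m ⊖ n) ≈ m · 1# - n · 1#
  fromℤ-⊖ m zero = begin
    m · 1#          ≈⟨ +-identityʳ _ ⟨
    m · 1# + 0#     ≈⟨ +-congˡ -0#≈0# ⟨
    m · 1# + - 0#   ∎
  fromℤ-⊖ zero (suc n) = sym (+-identityˡ _)
  fromℤ-⊖ (suc m) (suc n) = begin
    fromℤ (suc m ⊖ suc n)         ≡⟨ ≡.cong fromℤ (ℤ.[1+m]⊖[1+n]≡m⊖n m n) ⟩
    fromℤ (m ⊖ n)                 ≈⟨ fromℤ-⊖ m n ⟩
    m · 1# - n · 1#               ≈⟨ cancel-1+ _ _ ⟨
    suc m · 1# - suc n · 1#       ∎

  fromℤ-+ : ∀ i j → fromℤ (i ℤ.+ j) ≈ fromℤ i + fromℤ j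
  fromℤ-+ (+ m)    (+ n)    = ×-homo-+ 1# m n
  fromℤ-+ (+ m)    -[1+ n ] = fromℤ-⊖ m (suc n)
  fromℤ-+ -[1+ m ] (+ n)    = trans (fromℤ-⊖ n (suc m)) (+-comm _ _)
  fromℤ-+ -[1+ m ] -[1+ n ] = begin
    - (suc (suc (m ℕ.+ n)) · 1#)
      ≡⟨ ≡.cong (λ k → - (k · 1#)) (≡.sym (ℕ.+-suc (suc m) n)) ⟩
    - ((suc m ℕ.+ suc n) · 1#)            ≈⟨ -‿cong (×-homo-+ 1# (suc m) (suc n)) ⟩
    - (suc m · 1# + suc n · 1#)           ≈⟨ ⁻¹-∙-comm _ _ ⟨
    - (suc m · 1#) + - (suc n · 1#)       ∎

  fromℤ-◃⁻ : ∀ n → fromℤ (Sign.- ◃ n) ≈ - (n · 1#)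
  fromℤ-◃⁻ zero    = sym -0#≈0#
  fromℤ-◃⁻ (suc n) = refl

  fromℤ-◃⁺ : ∀ n → fromℤ (Sign.+ ◃ n) ≈ n · 1#
  fromℤ-◃⁺ zero    = refl
  fromℤ-◃⁺ (suc n) = refl

  fromℤ-* : ∀ i j → fromℤ (i ℤ.* j) ≈ fromℤ i * fromℤ j
  fromℤ-* (+ m) (+ n) = trans (fromℤ-◃⁺ (m ℕ.* n)) (×1-homo-* m n)
  fromℤ-* (+ m) -[1+ n ] = begin
    fromℤ (Sign.- ◃ m ℕ.* suc n)      ≈⟨ fromℤ-◃⁻ (m ℕ.* suc n) ⟩
    - ((m ℕ.* suc n) · 1#)            ≈⟨ -‿cong (×1-homo-* m (suc n)) ⟩
    - (m · 1# * (suc n · 1#))         ≈⟨ -‿distribʳ-* _ _ ⟩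
    m · 1# * - (suc n · 1#)           ∎
  fromℤ-* -[1+ m ] (+ n) = begin
    fromℤ (Sign.- ◃ suc m ℕ.* n)      ≈⟨ fromℤ-◃⁻ (suc m ℕ.* n) ⟩
    - ((suc m ℕ.* n) · 1#)            ≈⟨ -‿cong (×1-homo-* (suc m) n) ⟩
    - (suc m · 1# * (n · 1#))         ≈⟨ -‿distribˡ-* _ _ ⟩
    - (suc m · 1#) * (n · 1#)         ∎
  fromℤ-* -[1+ m ] -[1+ n ] = begin
    (suc m ℕ.* suc n) · 1#                ≈⟨ ×1-homo-* (suc m) (suc n) ⟩
    suc m · 1# * (suc n · 1#)             ≈⟨ -‿involutive _ ⟨
    - - (suc m · 1# * (suc n · 1#))       ≈⟨ -‿cong (-‿distribˡ-* _ _) ⟩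
    - (- (suc m · 1#) * (suc n · 1#))     ≈⟨ -‿distribʳ-* _ _ ⟩
    - (suc m · 1#) * - (suc n · 1#)       ∎

  fromℤ-neg : ∀ i → fromℤ (ℤ.- i) ≈ - fromℤ i
  fromℤ-neg (+ zero)  = sym -0#≈0#
  fromℤ-neg (+ suc n) = refl
  fromℤ-neg -[1+ n ]  = sym (-‿involutive _)

  morphism : ℤ.+-*-rawRing -Raw-AlmostCommutative⟶ fromCommutativeRing R
  morphism = record
    { ⟦_⟧    = fromℤ
    ; +-homo = fromℤ-+
    ; *-homo = fromℤ-*
    ; -‿homo = fromℤ-neg
    ; 0-homo = refl
    ; 1-homo = ×-homo-1 1#
    }

  -- Distinct integers yield `nothing` and no refutation: their images may agree in positive
  -- characteristic.
  ≟-coefficient : ∀ i j → Maybe (fromℤ i ≈ fromℤ j)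
  ≟-coefficient i j with i ℤ.≟ j
  ... | yes ≡.refl = just refl
  ... | no _       = nothing

  open RingSolver ℤ.+-*-rawRing (fromCommutativeRing R) morphism ≟-coefficient public
    using (Polynomial; solve; con; _:+_; _:*_; _:-_; :-_; _:=_)

-- Signs and inverses in an ordered field

module OrderedFieldProperties {c ℓ₁ ℓ₂} (K : OrderedField c ℓ₁ ℓ₂) where
  open OrderedField K public
  open CommutativeRing commutativeRing public
    using (refl; sym; trans; reflexive; setoid; semiring; -‿cong; -‿inverseʳ;
           +-cong; +-congˡ; +-congʳ; +-identityˡ; +-identityʳ;
           *-congˡ; *-congʳ; *-assoc; *-identityˡ; *-identityʳ;
           zeroˡ; zeroʳ; distribʳ)
  open IntegerCoefficients commutativeRing public
    using (Polynomial; solve; con; _:+_; _:*_; _:-_; :-_; _:=_)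
  open IsStrictTotalOrder isStrictTotalOrder public
    using (compare; <-respʳ-≈; <-respˡ-≈)
    renaming (irrefl to <-irrefl; trans to <-trans)
  open SemiringSum semiring public using (sum-cong-≋; ∑-distrib-+; sum-replicate-zero)
  open import Relation.Binary.Reasoning.Setoid setoid

  private
    variable
      x y z : Carrier

  <⇒0< : x < y → 0# < y - x
  <⇒0< {x} x<y = <-respˡ-≈ (-‿inverseʳ x) (+-monoˡ-< (- x) x<y)

  -0≈0 : - 0# ≈ 0#
  -0≈0 = solve 0 (:- con (+ 0) := con (+ 0)) refl

  0≤- : x ≤ y → 0# ≤ y - x
  0≤- (inj₁ x<y) = inj₁ (<⇒0< x<y)
  0≤- {x} (inj₂ x≈y) = inj₂ (sym (trans (+-congʳ (sym x≈y)) (-‿inverseʳ x)))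

  -≤ : 0# ≤ x → y - x ≤ y
  -≤ {x} {y} (inj₁ 0<x) = inj₁ (<-respˡ-≈ (+-identityˡ _)
    (<-respʳ-≈ (solve 2 (λ x y → x :+ (y :- x) := y) refl x y) (+-monoˡ-< (y - x) 0<x)))
  -≤ {x} {y} (inj₂ 0≈x) = inj₂
    (trans (+-congˡ (trans (-‿cong (sym 0≈x)) -0≈0)) (+-identityʳ y))

  0<-+ : 0# < x → 0# < y → 0# < x + y
  0<-+ {x} {y} 0<x 0<y = <-trans 0<y (<-respˡ-≈ (+-identityˡ y) (+-monoˡ-< y 0<x))

  0<⇒≉0 : 0# < x → ¬ x ≈ 0#
  0<⇒≉0 0<x x≈0 = <-irrefl (sym x≈0) 0<x

  0<-⇒≉0 : 0# < - x → ¬ x ≈ 0#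
  0<-⇒≉0 0<-x x≈0 = 0<⇒≉0 0<-x (trans (-‿cong x≈0) -0≈0)

  0<⇒¬0<- : 0# < x → ¬ 0# < - x
  0<⇒¬0<- {x} 0<x 0<-x = 0<⇒≉0 (0<-+ 0<x 0<-x) (-‿inverseʳ x)

  -- Negativity is expressed as positivity of `- x`, the form that `*-pos` and `0<-+` accept.
  data SignOf (x : Carrier) : Set (c ⊔ ℓ₁ ⊔ ℓ₂) where
    positive : 0# < x → SignOf x
    null     : x ≈ 0# → SignOf x
    negative : 0# < - x → SignOf x

  sign : ∀ x → SignOf x
  sign x with compare 0# x
  ... | tri< 0<x _ _ = positive 0<x
  ... | tri≈ _ 0≈x _ = null (sym 0≈x)
  ... | tri> _ _ x<0 = negative (<-respʳ-≈ (+-identityˡ (- x)) (<⇒0< x<0))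

  0≤-* : 0# ≤ x → 0# ≤ y → 0# ≤ x * y
  0≤-* (inj₁ 0<x) (inj₁ 0<y) = inj₁ (*-pos 0<x 0<y)
  0≤-* (inj₁ 0<x) (inj₂ 0≈y) = inj₂ (sym (trans (*-congˡ (sym 0≈y)) (zeroʳ _)))
  0≤-* (inj₂ 0≈x) _          = inj₂ (sym (trans (*-congʳ (sym 0≈x)) (zeroˡ _)))

  0≤-+ : 0# ≤ x → 0# ≤ y → 0# ≤ x + y
  0≤-+ (inj₁ 0<x) (inj₁ 0<y) = inj₁ (0<-+ 0<x 0<y)
  0≤-+ (inj₁ 0<x) (inj₂ 0≈y) =
    inj₁ (<-respʳ-≈ (trans (sym (+-identityʳ _)) (+-congˡ 0≈y)) 0<x)
  0≤-+ {y = y} (inj₂ 0≈x) 0≤y with 0≤y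
  ... | inj₁ 0<y = inj₁ (<-respʳ-≈ (trans (sym (+-identityˡ _)) (+-congʳ 0≈x)) 0<y)
  ... | inj₂ 0≈y = inj₂ (trans (sym (+-identityˡ _)) (+-cong 0≈x 0≈y))

  0<-*-cancelʳ : 0# < x * y → 0# < y → 0# < x
  0<-*-cancelʳ {x} {y} 0<xy 0<y with sign x
  ... | positive 0<x  = 0<x
  ... | null x≈0      = contradiction (trans (*-congʳ x≈0) (zeroˡ y)) (0<⇒≉0 0<xy)
  ... | negative 0<-x = contradiction
    (<-respʳ-≈ (solve 2 (λ x y → (:- x) :* y := :- (x :* y)) refl x y) (*-pos 0<-x 0<y))
    (0<⇒¬0<- 0<xy)

  reciprocal : ¬ x ≈ 0# → ∃[ x⁻¹ ] x⁻¹ * x ≈ 1#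
  reciprocal {x} x≉0 =
    let x⁻¹ , x⁻¹x≈1 , _ = IsHeytingField.#⇒invertible isHeytingField x≉0
    -- Apartness of `x` from `0#` yields an inverse of the difference `x - 0#`.
    in  x⁻¹ , trans (*-congˡ (solve 1 (λ x → x := x :- con (+ 0)) refl x)) x⁻¹x≈1

  *≈0⇒≈0 : ¬ y ≈ 0# → x * y ≈ 0# → x ≈ 0#
  *≈0⇒≈0 {y} {x} y≉0 xy≈0 with reciprocal y≉0
  ... | y⁻¹ , y⁻¹y≈1 = begin
    x               ≈⟨ *-identityʳ x ⟨
    x * 1#          ≈⟨ *-congˡ y⁻¹y≈1 ⟨
    x * (y⁻¹ * y)   ≈⟨ solve 3 (λ x y z → x :* (z :* y) := z :* (x :* y)) refl x y y⁻¹ ⟩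
    y⁻¹ * (x * y)   ≈⟨ *-congˡ xy≈0 ⟩
    y⁻¹ * 0#        ≈⟨ zeroʳ y⁻¹ ⟩
    0#              ∎

  0<-reciprocal : 0# < x → ∃[ x⁻¹ ] 0# < x⁻¹ × x⁻¹ * x ≈ 1#
  0<-reciprocal {x} 0<x with reciprocal (0<⇒≉0 0<x)
  ... | x⁻¹ , x⁻¹x≈1 = x⁻¹ , 0<-*-cancelʳ (<-respʳ-≈ (sym x⁻¹x≈1) 0<1) 0<x , x⁻¹x≈1
    where
    0<1 : 0# < 1#
    -- If `1#` vanished, so would the positive `x`; and if `- 1#` is positive, then so is its square
    -- `1#`.
    0<1 with sign 1#
    ... | positive 0<1  = 0<1
    ... | null 1≈0      = contradiction
      (trans (sym (*-identityʳ x)) (trans (*-congˡ 1≈0) (zeroʳ x))) (0<⇒≉0 0<x)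
    ... | negative 0<-1 = <-respʳ-≈
      (trans (solve 1 (λ x → (:- x) :* (:- x) := x :* x) refl 1#) (*-identityʳ 1#))
      (*-pos 0<-1 0<-1)

-- Orientation and intersection of segments

module Orientation {c ℓ₁ ℓ₂} (K : OrderedField c ℓ₁ ℓ₂) where
  open OrderedFieldProperties K
  open Point
  open import Relation.Binary.Reasoning.Setoid setoid

  private
    variable
      a b p q : Point K
      m : ℕ

  _≈ₚ′_ : Rel (Point K) ℓ₁
  _≈ₚ′_ = _≈ₚ_ K

  -- Twice the signed area of the triangle abp.
  orient : Point K → Point K → Point K → Carrier
  orient a b p = (xcoord b - xcoord a) * (ycoord p - ycoord a) -
                 (ycoord b - ycoord a) * (xcoord p - xcoord a)

  orientᵖ : (xa ya xb yb xp yp : Polynomial m) → Polynomial m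
  orientᵖ xa ya xb yb xp yp = (xb :- xa) :* (yp :- ya) :- (yb :- ya) :* (xp :- xa)

  orient-rotate : ∀ a b p → orient b p a ≈ orient a b p
  orient-rotate (point xa ya) (point xb yb) (point xp yp) =
    solve 6 (λ xa ya xb yb xp yp →
      orientᵖ xb yb xp yp xa ya := orientᵖ xa ya xb yb xp yp)
      refl xa ya xb yb xp yp

  orient-swap : ∀ a b p → orient a p b ≈ - orient a b p
  orient-swap (point xa ya) (point xb yb) (point xp yp) =
    solve 6 (λ xa ya xb yb xp yp →
      orientᵖ xa ya xp yp xb yb := :- orientᵖ xa ya xb yb xp yp)
      refl xa ya xb yb xp yp

  orient-endˡ : ∀ a b → orient a b a ≈ 0#
  orient-endˡ (point xa ya) (point xb yb) =
    solve 4 (λ xa ya xb yb → orientᵖ xa ya xb yb xa ya := con (+ 0))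
      refl xa ya xb yb

  orient-endʳ : ∀ a b → orient a b b ≈ 0#
  orient-endʳ (point xa ya) (point xb yb) =
    solve 4 (λ xa ya xb yb → orientᵖ xa ya xb yb xb yb := con (+ 0))
      refl xa ya xb yb

  orient-cong : ∀ a b → p ≈ₚ′ q → orient a b p ≈ orient a b q
  orient-cong a b (x≈ , y≈) =
    +-cong (*-congˡ (+-congʳ y≈)) (-‿cong (*-congˡ (+-congʳ x≈)))

  between : Carrier → Point K → Point K → Point K
  between t a b = point ((1# - t) * xcoord a + t * xcoord b)
                        ((1# - t) * ycoord a + t * ycoord b)

  -- Orientation is affine in its last argument, and the weights `1# - t` and `t` sum to `1#`.
  orient-between : ∀ t a b p q →
    orient a b (between t p q) ≈ (1# - t) * orient a b p + t * orient a b q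
  orient-between t (point xa ya) (point xb yb) (point xp yp) (point xq yq) = begin
    _ ≈⟨ +-cong (*-congˡ (shift yp yq ya)) (-‿cong (*-congˡ (shift xp xq xa))) ⟩
    _ ≈⟨ solve 8 (λ s t u v xp xq yp yq →
           u :* (s :* yp :+ t :* yq) :- v :* (s :* xp :+ t :* xq) :=
           s :* (u :* yp :- v :* xp) :+ t :* (u :* yq :- v :* xq))
           refl (1# - t) t (xb - xa) (yb - ya) (xp - xa) (xq - xa) (yp - ya) (yq - ya) ⟩
    _ ∎
    where
    shift : ∀ x y z → (1# - t) * x + t * y - z ≈ (1# - t) * (x - z) + t * (y - z)
    shift x y z = begin
      (1# - t) * x + t * y - z ≈⟨ +-congˡ (-‿cong (*-identityˡ z)) ⟨
      -- The factor `1#` is made explicit so that the solver can treat `1#` as the variable `e`.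
      (1# - t) * x + t * y - 1# * z
        ≈⟨ solve 5 (λ e t x y z →
             (e :- t) :* x :+ t :* y :- e :* z :=
             (e :- t) :* (x :- z) :+ t :* (y :- z)) refl 1# t x y z ⟩
      (1# - t) * (x - z) + t * (y - z) ∎

  OnSegment-sym : ∀ a b → OnSegment K a b p → OnSegment K b a p
  OnSegment-sym a b (t , 0≤t , t≤1 , x≈ , y≈) =
    1# - t , 0≤1-t , 1-t≤1 , trans x≈ (flip _ _) , trans y≈ (flip _ _)
    where
    0≤1-t : 0# ≤ 1# - t
    0≤1-t = 0≤- t≤1
    1-t≤1 : 1# - t ≤ 1#
    1-t≤1 = -≤ 0≤t
    flip : ∀ x y → (1# - t) * x + t * y ≈ (1# - (1# - t)) * y + (1# - t) * x
    flip x y = solve 4 (λ e t x y →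
      (e :- t) :* x :+ t :* y := (e :- (e :- t)) :* y :+ (e :- t) :* x) refl 1# t x y

  OnSegment⇒orient≈0 : ∀ a b → OnSegment K a b p → orient a b p ≈ 0#
  OnSegment⇒orient≈0 a b (t , _ , _ , p≈) = begin
    _ ≈⟨ orient-cong a b p≈ ⟩
    _ ≈⟨ orient-between t a b a b ⟩
    _ ≈⟨ +-cong (*-congˡ (orient-endˡ a b)) (*-congˡ (orient-endʳ a b)) ⟩
    _ ≈⟨ +-cong (zeroʳ _) (zeroʳ _) ⟩
    _ ≈⟨ +-identityˡ 0# ⟩
    0# ∎

  SameSide : Point K → Point K → Point K → Point K → Set _
  SameSide a b p q = (0# < orient a b p × 0# < orient a b q) ⊎
                     (0# < - orient a b p × 0# < - orient a b q)

  -- Neither summand is negative, and one is positive since `t` and `1# - t` do not both vanish.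
  weighted≉0 : ∀ {t x y} → 0# ≤ t → t ≤ 1# → 0# < x → 0# < y →
               ¬ (1# - t) * x + t * y ≈ 0#
  weighted≉0 {t} {x} {y} (inj₁ 0<t) t≤1 0<x 0<y eq with 0≤- t≤1
  ... | inj₁ 0<1-t = 0<⇒≉0 (0<-+ (*-pos 0<1-t 0<x) (*-pos 0<t 0<y)) eq
  ... | inj₂ 0≈1-t = 0<⇒≉0 (*-pos 0<t 0<y)
    (trans (trans (sym (+-identityˡ _)) (+-congʳ (trans (sym (zeroˡ x)) (*-congʳ 0≈1-t)))) eq)
  weighted≉0 {t} {x} {y} (inj₂ 0≈t) _ 0<x 0<y eq = 0<⇒≉0 0<x (begin
    x                     ≈⟨ *-identityˡ x ⟨
    1# * x                ≈⟨ solve 3 (λ e x y →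
      e :* x := (e :- con (+ 0)) :* x :+ con (+ 0) :* y) refl 1# x y ⟩
    (1# - 0#) * x + 0# * y ≈⟨ +-cong (*-congʳ (+-congˡ (-‿cong 0≈t))) (*-congʳ 0≈t) ⟩
    (1# - t) * x + t * y  ≈⟨ eq ⟩
    0# ∎)

  -- A common point of two segments thus gives a linear equation for its parameter `t`, from which
  -- the next two lemmas draw their conclusions.
  orient-meet : ∀ a b u v {t} → OnSegment K a b p → p ≈ₚ′ between t u v →
                (1# - t) * orient a b u + t * orient a b v ≈ 0#
  orient-meet {p = p} a b u v {t} onab p≈ = begin
    (1# - t) * orient a b u + t * orient a b v  ≈⟨ orient-between t a b u v ⟨
    orient a b (between t u v)                  ≈⟨ orient-cong a b p≈ ⟨
    orient a b p                                ≈⟨ OnSegment⇒orient≈0 a b onab ⟩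
    0#                                          ∎

  SameSide⇒disjoint : ∀ a b u v → SameSide a b u v →
                      OnSegment K a b p → ¬ OnSegment K u v p
  SameSide⇒disjoint a b u v (inj₁ (0<u , 0<v)) onab (t , 0≤t , t≤1 , p≈) =
    weighted≉0 0≤t t≤1 0<u 0<v (orient-meet a b u v onab p≈)
  SameSide⇒disjoint a b u v (inj₂ (0<-u , 0<-v)) onab (t , 0≤t , t≤1 , p≈) =
    weighted≉0 0≤t t≤1 0<-u 0<-v (begin
      (1# - t) * - orient a b u + t * - orient a b v
        ≈⟨ solve 4 (λ s t x y → s :* :- x :+ t :* :- y := :- (s :* x :+ t :* y))
             refl (1# - t) t (orient a b u) (orient a b v) ⟩
      - ((1# - t) * orient a b u + t * orient a b v)
        ≈⟨ -‿cong (orient-meet a b u v onab p≈) ⟩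
      - 0#
        ≈⟨ -0≈0 ⟩
      0# ∎)

  -- The equation of `orient-meet` shrinks to `t * orient a b v ≈ 0#`, which forces `t ≈ 0#`.
  meetsAtEnd : ∀ a b u v → orient a b u ≈ 0# → ¬ orient a b v ≈ 0# →
               OnSegment K a b p → OnSegment K u v p → p ≈ₚ′ u
  meetsAtEnd a b u v u≈0 v≉0 onab (t , _ , _ , p≈@(x≈ , y≈)) =
    trans x≈ (at0 _ _) , trans y≈ (at0 _ _)
    where
    t≈0 : t ≈ 0#
    t≈0 = *≈0⇒≈0 v≉0 (begin
      t * orient a b v                            ≈⟨ +-identityˡ _ ⟨
      0# + t * orient a b v                       ≈⟨ +-congʳ (zeroʳ _) ⟨
      (1# - t) * 0# + t * orient a b v            ≈⟨ +-congʳ (*-congˡ u≈0) ⟨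
      (1# - t) * orient a b u + t * orient a b v  ≈⟨ orient-meet a b u v onab p≈ ⟩
      0#                                          ∎)
    at0 : ∀ x y → (1# - t) * x + t * y ≈ x
    at0 x y = begin
      (1# - t) * x + t * y    ≈⟨ +-cong (*-congʳ (+-congˡ (-‿cong t≈0))) (*-congʳ t≈0) ⟩
      (1# - 0#) * x + 0# * y  ≈⟨ solve 3 (λ e x y →
        (e :- con (+ 0)) :* x :+ con (+ 0) :* y := e :* x) refl 1# x y ⟩
      1# * x                  ≈⟨ *-identityˡ x ⟩
      x                       ∎

-- Point sets in convex position

module ConvexPosition {c ℓ₁ ℓ₂} (K : OrderedField c ℓ₁ ℓ₂) {n : ℕ}
                      (S : Vector (Point K) (suc n)) (isConvex : IsConvexPointSet K S) where
  open IsConvexPointSet isConvex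
  open OrderedFieldProperties K
  open Orientation K
  open Point
  open import Relation.Binary.Reasoning.Setoid setoid

  private
    variable
      i j k l : Fin (suc n)

  single : ∀ {m} → Fin m → Carrier → Vector Carrier m
  single zero    α zero    = α
  single zero    α (suc _) = 0#
  single (suc _) α zero    = 0#
  single (suc i) α (suc j) = single i α j

  single-≥0 : ∀ {m} (i : Fin m) {α} → 0# ≤ α → ∀ j → 0# ≤ single i α j
  single-≥0 zero    0≤α zero    = 0≤α
  single-≥0 zero    0≤α (suc _) = inj₂ refl
  single-≥0 (suc _) 0≤α zero    = inj₂ refl
  single-≥0 (suc i) 0≤α (suc j) = single-≥0 i 0≤α j

  sum-single : ∀ {m} (i : Fin m) α (g : Vector Carrier m) →
               sum (λ j → single i α j * g j) ≈ α * g i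
  sum-single {suc m} zero α g = begin
    α * g zero + sum (λ j → 0# * g (suc j)) ≈⟨ +-congˡ (sum-cong-≋ (λ j → zeroˡ (g (suc j)))) ⟩
    α * g zero + sum {m} (λ _ → 0#)         ≈⟨ +-congˡ (sum-replicate-zero m) ⟩
    α * g zero + 0#                         ≈⟨ +-identityʳ _ ⟩
    α * g zero                              ∎
  sum-single (suc i) α g = begin
    0# * g zero + sum (λ j → single i α j * g (suc j))
      ≈⟨ +-cong (zeroˡ _) (sum-single i α (λ j → g (suc j))) ⟩
    0# + α * g (suc i)
      ≈⟨ +-identityˡ _ ⟩
    α * g (suc i) ∎

  -- Dividing the weights by their positive sum makes `S i` a convex combination of other points.
  -- The corners may coincide, since weights at equal indices add up in `w`; `⊏⇒area≉0` uses such a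
  -- degenerate triangle.
  notInTriangle : i ≢ j → i ≢ k → i ≢ l → ∀ {α β γ} → 0# ≤ α → 0# ≤ β → 0# ≤ γ →
    0# < α + β + γ →
    (∀ (f : Point K → Carrier) → f ≡ xcoord ⊎ f ≡ ycoord →
       (α + β + γ) * f (S i) ≈ α * f (S j) + β * f (S k) + γ * f (S l)) →
    ⊥
  notInTriangle {i} {j} {k} {l} i≢j i≢k i≢l {α} {β} {γ} 0≤α 0≤β 0≤γ 0<σ eq
    with 0<-reciprocal 0<σ
  ... | σ⁻¹ , 0<σ⁻¹ , σ⁻¹σ≈1 = convexPosition i
    (w , w≥0 , sum-w , coord xcoord (inj₁ ≡.refl) , coord ycoord (inj₂ ≡.refl))
    where
    w : Vector Carrier n
    w o = single (punchOut i≢j) (σ⁻¹ * α) o + single (punchOut i≢k) (σ⁻¹ * β) o +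
          single (punchOut i≢l) (σ⁻¹ * γ) o
    w≥0 : ∀ o → 0# ≤ w o
    w≥0 o = 0≤-+ (0≤-+ (single-≥0 (punchOut i≢j) (0≤-* (inj₁ 0<σ⁻¹) 0≤α) o)
                       (single-≥0 (punchOut i≢k) (0≤-* (inj₁ 0<σ⁻¹) 0≤β) o))
                 (single-≥0 (punchOut i≢l) (0≤-* (inj₁ 0<σ⁻¹) 0≤γ) o)
    sum-w* : ∀ g → sum (λ o → w o * g o) ≈
             σ⁻¹ * α * g (punchOut i≢j) + σ⁻¹ * β * g (punchOut i≢k) +
             σ⁻¹ * γ * g (punchOut i≢l)
    sum-w* g = begin
      sum (λ o → w o * g o)
        ≈⟨ sum-cong-≋ (λ o → trans (distribʳ (g o) _ _) (+-congʳ (distribʳ (g o) _ _))) ⟩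
      sum (λ o → wj o * g o + wk o * g o + wl o * g o)
        ≈⟨ ∑-distrib-+ (λ o → wj o * g o + wk o * g o) (λ o → wl o * g o) ⟩
      sum (λ o → wj o * g o + wk o * g o) + sum (λ o → wl o * g o)
        ≈⟨ +-congʳ (∑-distrib-+ (λ o → wj o * g o) (λ o → wk o * g o)) ⟩
      sum (λ o → wj o * g o) + sum (λ o → wk o * g o) + sum (λ o → wl o * g o)
        ≈⟨ +-cong (+-cong (sum-single (punchOut i≢j) _ g)
                          (sum-single (punchOut i≢k) _ g))
                  (sum-single (punchOut i≢l) _ g) ⟩
      _ ∎
      where
      wj = single (punchOut i≢j) (σ⁻¹ * α)
      wk = single (punchOut i≢k) (σ⁻¹ * β)
      wl = single (punchOut i≢l) (σ⁻¹ * γ)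
    sum-w : sum w ≈ 1#
    sum-w = begin
      sum w                      ≈⟨ sum-cong-≋ (λ o → *-identityʳ (w o)) ⟨
      sum (λ o → w o * 1#)       ≈⟨ sum-w* (λ _ → 1#) ⟩
      σ⁻¹ * α * 1# + σ⁻¹ * β * 1# + σ⁻¹ * γ * 1#
        ≈⟨ solve 5 (λ s a b c e →
             s :* a :* e :+ s :* b :* e :+ s :* c :* e := s :* (a :+ b :+ c) :* e)
             refl σ⁻¹ α β γ 1# ⟩
      σ⁻¹ * (α + β + γ) * 1#     ≈⟨ *-identityʳ _ ⟩
      σ⁻¹ * (α + β + γ)          ≈⟨ σ⁻¹σ≈1 ⟩
      1#                         ∎
    at : ∀ (f : Point K → Carrier) {o} (i≢o : i ≢ o) →
         f (S (punchIn i (punchOut i≢o))) ≈ f (S o)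
    at f i≢o = reflexive (≡.cong (λ o → f (S o)) (punchIn-punchOut i≢o))
    coord : ∀ f → f ≡ xcoord ⊎ f ≡ ycoord → f (S i) ≈ sum (λ o → w o * f (removeAt S i o))
    coord f f-coord = begin
      f (S i)                             ≈⟨ *-identityˡ _ ⟨
      1# * f (S i)                        ≈⟨ *-congʳ σ⁻¹σ≈1 ⟨
      σ⁻¹ * (α + β + γ) * f (S i)         ≈⟨ *-assoc _ _ _ ⟩
      σ⁻¹ * ((α + β + γ) * f (S i))       ≈⟨ *-congˡ (eq f f-coord) ⟩
      σ⁻¹ * (α * f (S j) + β * f (S k) + γ * f (S l))
        ≈⟨ solve 7 (λ s a b c x y z →
             s :* (a :* x :+ b :* y :+ c :* z) :=
             s :* a :* x :+ s :* b :* y :+ s :* c :* z)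
             refl σ⁻¹ α β γ (f (S j)) (f (S k)) (f (S l)) ⟩
      σ⁻¹ * α * f (S j) + σ⁻¹ * β * f (S k) + σ⁻¹ * γ * f (S l)
        ≈⟨ +-cong (+-cong (*-congˡ (at f i≢j)) (*-congˡ (at f i≢k))) (*-congˡ (at f i≢l)) ⟨
      _                                   ≈⟨ sum-w* (λ o → f (removeAt S i o)) ⟨
      sum (λ o → w o * f (removeAt S i o)) ∎

  _⊏_ : Rel (Fin (suc n)) ℓ₂
  i ⊏ j = ycoord (S i) < ycoord (S j)

  ⊏⇒≢ : i ⊏ j → i ≢ j
  ⊏⇒≢ i⊏j ≡.refl = <-irrefl refl i⊏j

  ⊏-compare : i ≢ j → i ⊏ j ⊎ j ⊏ i
  ⊏-compare {i} {j} i≢j with compare (ycoord (S i)) (ycoord (S j))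
  ... | tri< i⊏j _ _ = inj₁ i⊏j
  ... | tri≈ _ i≈j _ = contradiction i≈j (distinctHeights i≢j)
  ... | tri> _ _ j⊏i = inj₂ j⊏i

  area : Fin (suc n) → Fin (suc n) → Fin (suc n) → Carrier
  area i j k = orient (S i) (S j) (S k)

  -- Otherwise the middle point `j` lies on the segment `ik`. The weights are the height
  -- differences: they reproduce the height of `j` identically and its x-coordinate up to
  -- `area i j k`.
  ⊏⇒area≉0 : i ⊏ j → j ⊏ k → ¬ area i j k ≈ 0#
  ⊏⇒area≉0 {i} {j} {k} i⊏j j⊏k area≈0 =
    notInTriangle (⊏⇒≢ i⊏j ∘ ≡.sym) (⊏⇒≢ j⊏k) (⊏⇒≢ j⊏k)
      (inj₁ (<⇒0< j⊏k)) (inj₁ (<⇒0< i⊏j)) (inj₂ refl)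
      (<-respʳ-≈ (sym (+-identityʳ _)) (0<-+ (<⇒0< j⊏k) (<⇒0< i⊏j)))
      λ { _ (inj₁ ≡.refl) → begin
            _ ≈⟨ solve 6 (λ xi yi xj yj xk yk →
                   ((yk :- yj) :+ (yj :- yi) :+ con (+ 0)) :* xj :=
                   (yk :- yj) :* xi :+ (yj :- yi) :* xk :+ con (+ 0) :* xk
                   :+ orientᵖ xi yi xj yj xk yk)
                   refl (xcoord (S i)) (ycoord (S i)) (xcoord (S j))
                        (ycoord (S j)) (xcoord (S k)) (ycoord (S k)) ⟩
            _ ≈⟨ +-congˡ area≈0 ⟩
            _ ≈⟨ +-identityʳ _ ⟩
            _ ∎
        ; _ (inj₂ ≡.refl) → solve 3 (λ yi yj yk →
            ((yk :- yj) :+ (yj :- yi) :+ con (+ 0)) :* yj :=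
            (yk :- yj) :* yi :+ (yj :- yi) :* yk :+ con (+ 0) :* yk)
            refl (ycoord (S i)) (ycoord (S j)) (ycoord (S k)) }

  -- The affine dependence of four points in the plane: each is weighted, up to sign, by the area of
  -- the triangle of the other three.
  barycentric : ∀ i j k l (f : Point K → Carrier) → f ≡ xcoord ⊎ f ≡ ycoord →
    (- area j k l + area i k l + area i j k) * f (S k) ≈
    - area j k l * f (S i) + area i k l * f (S j) + area i j k * f (S l)
  barycentric i j k l _ (inj₁ ≡.refl) = solve 8 (λ xi yi xj yj xk yk xl yl →
    (:- orientᵖ xj yj xk yk xl yl :+ orientᵖ xi yi xk yk xl yl
      :+ orientᵖ xi yi xj yj xk yk) :* xk :=
    (:- orientᵖ xj yj xk yk xl yl) :* xi :+ orientᵖ xi yi xk yk xl yl :* xj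
      :+ orientᵖ xi yi xj yj xk yk :* xl)
    refl (xcoord (S i)) (ycoord (S i)) (xcoord (S j)) (ycoord (S j))
         (xcoord (S k)) (ycoord (S k)) (xcoord (S l)) (ycoord (S l))
  barycentric i j k l _ (inj₂ ≡.refl) = solve 8 (λ xi yi xj yj xk yk xl yl →
    (:- orientᵖ xj yj xk yk xl yl :+ orientᵖ xi yi xk yk xl yl
      :+ orientᵖ xi yi xj yj xk yk) :* yk :=
    (:- orientᵖ xj yj xk yk xl yl) :* yi :+ orientᵖ xi yi xk yk xl yl :* yj
      :+ orientᵖ xi yi xj yj xk yk :* yl)
    refl (xcoord (S i)) (ycoord (S i)) (xcoord (S j)) (ycoord (S j))
         (xcoord (S k)) (ycoord (S k)) (xcoord (S l)) (ycoord (S l))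

  topmost : ∃[ t ] ∀ {i} → i ≢ t → i ⊏ t
  topmost =
    let t , t-top = go n id
    in  t , λ {i} i≢t → [ (λ i≡t → contradiction i≡t i≢t) , id ]′ (t-top i)
    where
    go : ∀ m (f : Fin (suc m) → Fin (suc n)) →
         ∃[ t ] ∀ i → f i ≡ t ⊎ f i ⊏ t
    go zero    f = f zero , λ { zero → inj₁ ≡.refl }
    go (suc m) f with go m (f ∘ suc)
    ... | t , t-top with f zero ≟ t
    ...   | yes f0≡t = t , λ { zero → inj₁ f0≡t ; (suc i) → t-top i }
    ...   | no  f0≢t with ⊏-compare f0≢t
    ...     | inj₁ f0⊏t = t , λ { zero → inj₂ f0⊏t ; (suc i) → t-top i }
    ...     | inj₂ t⊏f0 = f zero , λ
      { zero    → inj₁ ≡.refl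
      ; (suc i) → inj₂ ([ (λ { ≡.refl → t⊏f0 }) , (λ i⊏t → <-trans i⊏t t⊏f0) ]′ (t-top i)) }

  -- The angular order around the topmost point

  module AroundTop (t : Fin (suc n)) (below : ∀ {i} → i ≢ t → i ⊏ t) where

    -- The point `t` needs its own constructor, as areas with `t` as a repeated corner vanish. The
    -- other points lie in the open half-plane below `t`, so orientation orders them linearly.
    data _≺_ : Rel (Fin (suc n)) (c ⊔ ℓ₂) where
      top≺ : j ≢ t → t ≺ j
      ccw  : i ≢ t → j ≢ t → 0# < area t i j → i ≺ j

    ≺-asym : Asymmetric _≺_
    ≺-asym (top≺ j≢t)   (top≺ t≢t)    = t≢t ≡.refl
    ≺-asym (top≺ _)     (ccw _ t≢t _) = t≢t ≡.refl
    ≺-asym (ccw _ t≢t _) (top≺ _)     = t≢t ≡.refl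
    ≺-asym {i} {j} (ccw _ _ ij) (ccw _ _ ji) =
      0<⇒¬0<- ij (<-respʳ-≈ (orient-swap (S t) (S i) (S j)) ji)

    -- With `t` the highest, comparing `i` and `j` sorts the three points by height, as `⊏⇒area≉0`
    -- requires.
    area-top≉0 : i ≢ t → j ≢ t → i ≢ j → ¬ area t i j ≈ 0#
    area-top≉0 {i} {j} i≢t j≢t i≢j tij≈0 with ⊏-compare i≢j
    ... | inj₁ i⊏j = ⊏⇒area≉0 i⊏j (below j≢t)
      (trans (orient-rotate (S t) (S i) (S j)) tij≈0)
    ... | inj₂ j⊏i = ⊏⇒area≉0 j⊏i (below i≢t)
      (trans (orient-rotate (S t) (S j) (S i))
        (trans (orient-swap (S t) (S i) (S j)) (trans (-‿cong tij≈0) -0≈0)))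

    ≺-total : i ≢ j → i ≺ j ⊎ j ≺ i
    ≺-total {i} {j} i≢j with i ≟ t | j ≟ t
    ... | yes ≡.refl | _          = inj₁ (top≺ (i≢j ∘ ≡.sym))
    ... | no _       | yes ≡.refl = inj₂ (top≺ i≢j)
    ... | no i≢t     | no j≢t with sign (area t i j)
    ...   | positive 0<tij  = inj₁ (ccw i≢t j≢t 0<tij)
    ...   | null tij≈0      = contradiction tij≈0 (area-top≉0 i≢t j≢t i≢j)
    ...   | negative 0<-tij =
      inj₂ (ccw j≢t i≢t (<-respʳ-≈ (sym (orient-swap (S t) (S i) (S j))) 0<-tij))

    ≺-trans : Transitive _≺_
    ≺-trans (top≺ _)        (top≺ k≢t)       = top≺ k≢t
    ≺-trans (top≺ _)        (ccw _ k≢t _)    = top≺ k≢t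
    ≺-trans (ccw _ t≢t _)   (top≺ _)         = contradiction ≡.refl t≢t
    ≺-trans {i} {j} {k} (ccw i≢t j≢t ij) (ccw _ k≢t jk) = ccw i≢t k≢t
      (0<-*-cancelʳ
        (<-respʳ-≈
          -- This is the y-component of the linear dependence between the vectors from `t` to `i`,
          -- `j` and `k`. Its height factors are positive because `t` is topmost.
          (solve 8 (λ xt yt xi yi xj yj xk yk →
            orientᵖ xt yt xi yi xj yj :* (yt :- yk)
              :+ orientᵖ xt yt xj yj xk yk :* (yt :- yi) :=
            orientᵖ xt yt xi yi xk yk :* (yt :- yj))
            refl (xcoord (S t)) (ycoord (S t)) (xcoord (S i)) (ycoord (S i))
                 (xcoord (S j)) (ycoord (S j)) (xcoord (S k)) (ycoord (S k)))
          (0<-+ (*-pos ij (<⇒0< (below k≢t))) (*-pos jk (<⇒0< (below i≢t)))))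
        (<⇒0< (below j≢t)))

    ≺⇒≢ : i ≺ j → i ≢ j
    ≺⇒≢ i≺j ≡.refl = ≺-asym i≺j i≺j

    -- Otherwise j would lie in the triangle tik.
    ≺⇒0<area : i ≺ j → j ≺ k → 0# < area i j k
    ≺⇒0<area (top≺ t≢t)    (top≺ _)      = contradiction ≡.refl t≢t
    ≺⇒0<area (ccw _ t≢t _) (top≺ _)      = contradiction ≡.refl t≢t
    ≺⇒0<area (top≺ _)      (ccw _ _ tjk) = tjk
    ≺⇒0<area {i} {j} {k} i≺j@(ccw i≢t j≢t tij) j≺k@(ccw _ _ tjk)
      with sign (area i j k)
    ... | positive 0<ijk  = 0<ijk
    ... | null ijk≈0      = ⊥-elim (notInTriangle j≢t (≺⇒≢ i≺j ∘ ≡.sym) (≺⇒≢ j≺k)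
      (inj₂ 0≈-ijk) (inj₁ tjk) (inj₁ tij)
      (<-respʳ-≈ (+-congʳ (trans (sym (+-identityˡ _)) (+-congʳ 0≈-ijk))) (0<-+ tjk tij))
      (barycentric t i j k))
      where
      0≈-ijk : 0# ≈ - area i j k
      0≈-ijk = sym (trans (-‿cong ijk≈0) -0≈0)
    ... | negative 0<-ijk = ⊥-elim (notInTriangle j≢t (≺⇒≢ i≺j ∘ ≡.sym) (≺⇒≢ j≺k)
      (inj₁ 0<-ijk) (inj₁ tjk) (inj₁ tij)
      (0<-+ (0<-+ 0<-ijk tjk) tij)
      (barycentric t i j k))

    -- If `j` were above both `i` and `k`, the heights in `barycentric` would make a sum of three
    -- positive products vanish.
    valley : i ≺ j → j ≺ k → j ⊏ i ⊎ j ⊏ k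
    valley (top≺ j≢t)    _             = inj₁ (below j≢t)
    valley (ccw _ t≢t _) (top≺ _)      = contradiction ≡.refl t≢t
    valley {i} {j} {k} i≺j@(ccw _ j≢t tij) j≺k@(ccw _ _ tjk)
      with ⊏-compare (≺⇒≢ i≺j) | ⊏-compare (≺⇒≢ j≺k)
    ... | inj₂ j⊏i | _        = inj₁ j⊏i
    ... | inj₁ _   | inj₁ j⊏k = inj₂ j⊏k
    ... | inj₁ i⊏j | inj₂ k⊏j = contradiction
      (begin
        area i j k * (y t - y j) + area t j k * (y j - y i) + area t i j * (y j - y k)
          ≈⟨ solve 7 (λ a b d yt yi yj yk →
               a :* (yt :- yj) :+ b :* (yj :- yi) :+ d :* (yj :- yk) :=
               (:- a :+ b :+ d) :* yj :- (:- a :* yt :+ b :* yi :+ d :* yk))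
               refl (area i j k) (area t j k) (area t i j) (y t) (y i) (y j) (y k) ⟩
        _ ≈⟨ +-congʳ (barycentric t i j k ycoord (inj₂ ≡.refl)) ⟩
        _ ≈⟨ -‿inverseʳ _ ⟩
        0# ∎)
      (0<⇒≉0 (0<-+ (0<-+ (*-pos (≺⇒0<area i≺j j≺k) (<⇒0< (below j≢t)))
                         (*-pos tjk (<⇒0< i⊏j)))
                   (*-pos tij (<⇒0< k⊏j))))
      where
      y : Fin (suc n) → Carrier
      y i = ycoord (S i)

    -- Not symmetric: k is the end-point of kl that lies between i and j.
    Crossing : (i j k l : Fin (suc n)) → Set _
    Crossing i j k l = (i ≺ k × k ≺ j) × (j ≺ l ⊎ l ≺ i)

    -- Bring the three points into their order under `≺`, where the area is positive; a rotation
    -- keeps this sign and a swap reverses it.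
    side : i ≺ j → k ≢ i → k ≢ j →
           ((i ≺ k × k ≺ j) × 0# < - area i j k) ⊎
           ((j ≺ k ⊎ k ≺ i) × 0# < area i j k)
    side {i} {j} {k} i≺j k≢i k≢j with ≺-total k≢i | ≺-total k≢j
    ... | inj₁ k≺i | _        = inj₂ (inj₂ k≺i ,
      <-respʳ-≈ (sym (orient-rotate (S k) (S i) (S j))) (≺⇒0<area k≺i i≺j))
    ... | inj₂ _   | inj₂ j≺k = inj₂ (inj₁ j≺k , ≺⇒0<area i≺j j≺k)
    ... | inj₂ i≺k | inj₁ k≺j = inj₁ ((i≺k , k≺j) ,
      <-respʳ-≈ (orient-swap (S i) (S j) (S k)) (≺⇒0<area i≺k k≺j))

    area≉0 : i ≺ j → k ≢ i → k ≢ j → ¬ area i j k ≈ 0#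
    area≉0 i≺j k≢i k≢j with side i≺j k≢i k≢j
    ... | inj₁ (_ , 0<-ijk) = 0<-⇒≉0 0<-ijk
    ... | inj₂ (_ , 0<ijk)  = 0<⇒≉0 0<ijk

    -- On different sides, one of `k` and `l` would be between `i` and `j` and the other not, which
    -- is a crossing in one of the two readings.
    sameSide : i ≺ j → k ≢ i → k ≢ j → l ≢ i → l ≢ j →
               ¬ Crossing i j k l → ¬ Crossing i j l k →
               SameSide (S i) (S j) (S k) (S l)
    sameSide i≺j k≢i k≢j l≢i l≢j ¬kl ¬lk with side i≺j k≢i k≢j | side i≺j l≢i l≢j
    ... | inj₁ (_ , 0<-k)    | inj₁ (_ , 0<-l)    = inj₂ (0<-k , 0<-l)
    ... | inj₂ (_ , 0<k)     | inj₂ (_ , 0<l)     = inj₁ (0<k , 0<l)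
    ... | inj₁ (inside , _)  | inj₂ (outside , _) = contradiction (inside , outside) ¬kl
    ... | inj₂ (outside , _) | inj₁ (inside , _)  = contradiction (inside , outside) ¬lk

    end⇒area≈0 : k ≡ i ⊎ k ≡ j → area i j k ≈ 0#
    end⇒area≈0 {i} {_} {j} (inj₁ ≡.refl) = orient-endˡ (S i) (S j)
    end⇒area≈0 {_} {i} {j} (inj₂ ≡.refl) = orient-endʳ (S i) (S j)

    SharedEnd : (i j k l : Fin (suc n)) → Point K → Set _
    SharedEnd i j k l p = ((k ≡ i ⊎ k ≡ j) × _≈ₚ_ K p (S k)) ⊎
                          ((l ≡ i ⊎ l ≡ j) × _≈ₚ_ K p (S l))

    chords-meet : ∀ {p} → i ≺ j → ¬ Crossing i j k l → ¬ Crossing i j l k →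
                  ¬ ((k ≡ i ⊎ k ≡ j) × (l ≡ i ⊎ l ≡ j)) →
                  OnSegment K (S i) (S j) p → OnSegment K (S k) (S l) p →
                  SharedEnd i j k l p
    chords-meet {i} {j} {k} {l} i≺j ¬kl ¬lk ¬both pij pkl
      with k ≟ i ⊎-dec k ≟ j | l ≟ i ⊎-dec l ≟ j
    ... | yes k∈ | yes l∈ = contradiction (k∈ , l∈) ¬both
    ... | yes k∈ | no l∉  = inj₁ (k∈ , meetsAtEnd (S i) (S j) (S k) (S l)
      (end⇒area≈0 k∈) (area≉0 i≺j (l∉ ∘ inj₁) (l∉ ∘ inj₂)) pij pkl)
    ... | no k∉  | yes l∈ = inj₂ (l∈ , meetsAtEnd (S i) (S j) (S l) (S k)
      (end⇒area≈0 l∈) (area≉0 i≺j (k∉ ∘ inj₁) (k∉ ∘ inj₂)) pij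
      (OnSegment-sym (S k) (S l) pkl))
    ... | no k∉  | no l∉  = contradiction pkl (SameSide⇒disjoint (S i) (S j) (S k) (S l)
      (sameSide i≺j (k∉ ∘ inj₁) (k∉ ∘ inj₂) (l∉ ∘ inj₁) (l∉ ∘ inj₂) ¬kl ¬lk) pij)

-- Sorting a list without repetitions

module _ {a ℓ} {A : Set a} {_≺_ : Rel A ℓ} (≺-trans : Transitive _≺_)
         (≺-total : ∀ {x y} → x ≢ y → x ≺ y ⊎ y ≺ x) where

  -- Distinctness is assumed because `≺-total` compares only distinct elements.
  insert : ∀ x {xs} → All (x ≢_) xs → AllPairs _≺_ xs →
           ∃[ ys ] AllPairs _≺_ ys × ys ↭ x ∷ xs
  insert x []           []         = _ , [] ∷ [] , ↭-refl
  insert x (x≢y ∷ x≢xs) (y≺ ∷ xs!) with ≺-total x≢y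
  ... | inj₁ x≺y = _ , (x≺y ∷ All.map (≺-trans x≺y) y≺) ∷ y≺ ∷ xs! , ↭-refl
  ... | inj₂ y≺x =
    let _ , ys! , ys↭ = insert x x≢xs xs!
    in  _ , All-resp-↭ (↭-sym ys↭) (y≺x ∷ y≺) ∷ ys! ,
        ↭-trans (prep _ ys↭) (swap _ _ ↭-refl)

  sort : ∀ {xs} → Unique xs → ∃[ ys ] AllPairs _≺_ ys × ys ↭ xs
  sort []            = _ , [] , ↭-refl
  sort (x≢xs ∷ xs!) =
    let _ , ys! , ys↭ = sort xs!
        _ , zs! , zs↭ = insert _ (All-resp-↭ (↭-sym ys↭) x≢xs) ys!
    in  _ , zs! , ↭-trans zs↭ (prep _ ys↭)

-- From the layout to the embedding

theorem2 : ∀ {c ℓ₁ ℓ₂} (K : OrderedField c ℓ₁ ℓ₂) (n : ℕ) →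
    (T : Digraph (suc n)) → IsSwitchTree T →
    (S : Vector (Point K) (suc n)) → IsConvexPointSet K S →
    HasUPSE K T S
theorem2 K n T isSwitchTree S isConvex
  with ConvexPosition.topmost K S isConvex
     | spanningTree T (IsDirectedTree.connected (IsSwitchTree.isDirectedTree isSwitchTree)) zero
... | top , below | _ , t , all∈ = φ , record
  { injective = inj′ ; upward = up (all∈ _) (all∈ _) ; planar = planar }
  where
  open Digraph T
  open ConvexPosition K S isConvex
  open AroundTop top below
  open IsDirectedTree (IsSwitchTree.isDirectedTree isSwitchTree) using (asymmetric)
  open OrderedFieldProperties K using (<-trans)
  open Layouts T _≺_ _⊏_ ≺-asym <-trans (⊏-compare ∘ ≺⇒≢) valley
  open Orientation K using (OnSegment-sym)

  -- Vertices and points are both indexed by Fin (suc n), so the list of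
  -- all vertices also serves as the list of all points.
  sorted = sort ≺-trans ≺-total (Rooted-unique T t)
  laidOut = layout isSwitchTree t (proj₁ sorted) (proj₁ (proj₂ sorted))
                   (↭-length (proj₂ (proj₂ sorted)))
  φ = proj₁ laidOut
  open Layout (proj₁ (proj₂ laidOut))

  inj′ : ∀ {u v} → φ u ≡ φ v → u ≡ v
  inj′ = inj (all∈ _) (all∈ _)

  noCrossing : ∀ {u v x y} → Adj T u v → Adj T x y → ¬ Crossing (φ u) (φ v) (φ x) (φ y)
  noCrossing uv xy ((u≺x , x≺v) , inj₁ v≺y) =
    nocross (all∈ _) (all∈ _) (all∈ _) (all∈ _) uv xy u≺x x≺v v≺y
  -- Here the alternation starts at `y`, so the edges exchange their roles.
  noCrossing uv xy ((u≺x , x≺v) , inj₂ y≺u) =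
    nocross (all∈ _) (all∈ _) (all∈ _) (all∈ _) (Adj-sym T xy) uv y≺u u≺x x≺v

  -- Otherwise the two arcs are equal or opposite, or one is a loop; asymmetry excludes loops and
  -- opposite arcs.
  distinctArcs : ∀ {u v x y} → Arc u v → Arc x y → ¬ (u ≡ x × v ≡ y) →
                 ¬ ((φ x ≡ φ u ⊎ φ x ≡ φ v) × (φ y ≡ φ u ⊎ φ y ≡ φ v))
  distinctArcs uv xy ≢ (x∈ , y∈) with Sum.map inj′ inj′ x∈ | Sum.map inj′ inj′ y∈
  ... | inj₁ ≡.refl | inj₁ ≡.refl = asymmetric xy xy
  ... | inj₁ ≡.refl | inj₂ ≡.refl = ≢ (≡.refl , ≡.refl)
  ... | inj₂ ≡.refl | inj₁ ≡.refl = asymmetric uv xy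
  ... | inj₂ ≡.refl | inj₂ ≡.refl = asymmetric xy xy

  planar : ∀ {u v x y} → Arc u v → Arc x y → ¬ (u ≡ x × v ≡ y) →
           ∀ p → OnSegment K (S (φ u)) (S (φ v)) p → OnSegment K (S (φ x)) (S (φ y)) p →
           ∃[ w ] (w ≡ u ⊎ w ≡ v) × (w ≡ x ⊎ w ≡ y) × _≈ₚ_ K p (S (φ w))
  planar {u} {v} {x} {y} uv xy ≢ p puv pxy =
    shared (meet (≺-total (⊏⇒≢ (up (all∈ u) (all∈ v) uv))))
    where
    meet : φ u ≺ φ v ⊎ φ v ≺ φ u → SharedEnd (φ u) (φ v) (φ x) (φ y) p
    meet (inj₁ u≺v) = chords-meet u≺v
      (noCrossing (inj₁ uv) (inj₁ xy)) (noCrossing (inj₁ uv) (inj₂ xy))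
      (distinctArcs uv xy ≢) puv pxy
    -- `chords-meet` expects the first chord in increasing order, so the arc is read backwards.
    meet (inj₂ v≺u) = Sum.map (Product.map₁ Sum.swap) (Product.map₁ Sum.swap)
      (chords-meet v≺u
      (noCrossing (inj₂ uv) (inj₁ xy)) (noCrossing (inj₂ uv) (inj₂ xy))
      (distinctArcs uv xy ≢ ∘ Product.map Sum.swap Sum.swap)
      (OnSegment-sym (S (φ u)) (S (φ v)) puv) pxy)
    shared : SharedEnd (φ u) (φ v) (φ x) (φ y) p →
             ∃[ w ] (w ≡ u ⊎ w ≡ v) × (w ≡ x ⊎ w ≡ y) × _≈ₚ_ K p (S (φ w))
    shared (inj₁ (x∈ , p≈x)) = x , Sum.map inj′ inj′ x∈ , inj₁ ≡.refl , p≈x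
    shared (inj₂ (y∈ , p≈y)) = y , Sum.map inj′ inj′ y∈ , inj₂ ≡.refl , p≈y
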